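{- For every input sequence of requests $\sigma$ of the List Update with Delays problem, the algorithm ALG described in the context satisfies $$ALG(\sigma)\le 336\cdot OPT(\sigma).$$
   Context: List Update with Delays. A set $\mathbb{E}$ of $n$ elements is kept in an ordered list (position $1$ is the head). An input $\sigma$ is a sequence of requests $r_1,\dots,r_m$; request $r_k$ specifies an element $e_k\in\mathbb{E}$, an arrival time $a_k$ and a delay function $D_k$ which is non-negative, non-decreasing, and $0$ up to time $a_k$. At any time an algorithm may (a) perform an access up to position $i$, at cost $i$, which serves every pending request (arrived, not yet served) whose element currently lies in positions $1,\dots,i$; (b) swap two adjacent elements at cost $1$. Actions are instantaneous. A request served at time $s$ incurs delay cost $D_k(s)$ (a request never served incurs $\sup_t D_k(t)$). The cost of an algorithm is total access cost plus number of swaps plus total delay cost. An online algorithm knows at time $t$ only the requests arrived by time $t$ and their delay functions up to time $t$. $OPT(\sigma)$ is the minimum cost of an offline solution starting from the same initial list. Algorithm ALG maintains a request counter $RC_k$ for each request and an element counter $EC_e$ for each element. $EC_e=0$ initially for all $e$. When $r_k$ arrives, $RC_k$ is created with value $0$. While $r_k$ is pending in ALG, $RC_k$ increases by exactly the delay $r_k$ incurs, and $EC_{e_k}$ increases by the same amount (so $EC_e$ grows at the total rate of delay of pending requests for $e$); after $r_k$ is served $RC_k$ stops increasing, until it is deleted. Events: (i) Prefix-request-counters event on $\ell\in[n]$: occurs when the sum of the (non-deleted) request counters of requests whose elements are currently in positions $1,\dots,\ell$ reaches $\ell$. ALG then accesses the first $\min(2\ell,n)$ positions and deletes the request counters of requests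 for the elements in the first $\ell$ positions. (ii) Element-counter event on $e$: occurs when $EC_e$ reaches the current position $\ell$ of $e$. ALG then accesses the first $\min(2\ell,n)$ positions, deletes all request counters of requests for $e$, sets $EC_e\leftarrow 0$, and moves $e$ to the front of its list by $\ell-1$ adjacent swaps.
   Formalization: Only inputs on which every counter meets its threshold exactly, never jumping past it (e.g. continuous delay functions), are covered; otherwise the claim fails: one request, n = 1, delay jumping from 0 to 1000 costs ALG at least 1000 but OPT only 1. -}

module Defs where

open import Algebra.Bundles using (CommutativeRing)
import Algebra.Properties.Monoid.Mult as Mult
import Algebra.Properties.Monoid.Sum as Sum
open import Data.Bool.Base using (Bool; false; if_then_else_)
open import Data.Fin.Base using (Fin; zero; suc; toℕ; inject₁; fromℕ<)
import Data.Fin.Properties as Fin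
open import Data.Fin.Permutation using (Permutation′; transpose; _∘ₚ_; _⟨$⟩ˡ_)
open import Data.List.Base using (List; []; _∷_; _++_; map; foldl)
import Data.Nat.ListAction as ℕ
open import Data.List.Relation.Unary.Linked using (Linked)
open import Data.Maybe.Base using (Maybe; just; nothing)
open import Data.Nat.Base as ℕ using (ℕ; suc; _⊓_; s≤s)
import Data.Nat.Properties as ℕ
open import Data.Product.Base using (∃-syntax; _×_; _,_; proj₁; proj₂)
open import Data.Vec.Functional using (Vector; foldr)
open import Level using (_⊔_) renaming (suc to lsuc)
open import Relation.Binary.Core using (Rel)
import Relation.Binary.Construct.Add.Supremum.NonStrict as AddSupremum
import Relation.Binary.Construct.NonStrictToStrict as ToStrict
open import Relation.Binary.Definitions using (Monotonic₁)
open import Relation.Binary.PropositionalEquality.Core as ≡ using (_≡_)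
open import Relation.Binary.Structures using (IsDecTotalOrder)
open import Relation.Nullary using (¬_; does; yes; no)
open import Relation.Nullary.Construct.Add.Supremum using (_⁺; [_]; ⊤⁺)
open import Relation.Unary using (Pred)

-- The real numbers, given by the axioms of a Dedekind-complete ordered field.
record RealNumbers c ℓ₁ ℓ₂ : Set (lsuc (c ⊔ ℓ₁ ⊔ ℓ₂)) where
  field
    commutativeRing : CommutativeRing c ℓ₁
  open CommutativeRing commutativeRing public
  field
    _≤_             : Rel Carrier ℓ₂
    isDecTotalOrder : IsDecTotalOrder _≈_ _≤_
    0≉1             : ¬ (0# ≈ 1#)
    inverse         : ∀ x → ¬ (x ≈ 0#) → ∃[ y ] x * y ≈ 1#
    +-monoʳ-≤       : ∀ z → Monotonic₁ _≤_ _≤_ (z +_)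
    *-nonNegative   : ∀ {x y} → 0# ≤ x → 0# ≤ y → 0# ≤ (x * y)

  UpperBound : ∀ {p} → Pred Carrier p → Pred Carrier (c ⊔ ℓ₂ ⊔ p)
  UpperBound P b = ∀ x → P x → x ≤ b

  field
    complete : (P : Pred Carrier (c ⊔ ℓ₁ ⊔ ℓ₂)) →
               ∃[ x ] P x → ∃[ b ] UpperBound P b →
               ∃[ s ] UpperBound P s × (∀ b → UpperBound P b → s ≤ b)

  open IsDecTotalOrder isDecTotalOrder public
    using (_≤?_)
  open ToStrict _≈_ _≤_ public using (_<_)
  open Mult +-monoid public using () renaming (_×_ to _·_)
  open Sum +-monoid public using (sum)

  infix 4 _≤_

  fromℕ : ℕ → Carrier
  fromℕ k = k · 1#

module ListUpdate {c ℓ₁ ℓ₂} (ℝ : RealNumbers c ℓ₁ ℓ₂) where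

  open RealNumbers ℝ

  -- Costs are real or infinite: a request that is never served may have an
  -- unbounded delay function.

  Cost : Set c
  Cost = Carrier ⁺

  open AddSupremum _≤_ public using (_≤⁺_)

  infixl 6 _+⁺_
  infixl 7 _*⁺_

  _+⁺_ : Cost → Cost → Cost
  [ x ] +⁺ [ y ] = [ x + y ]
  ⊤⁺    +⁺ _     = ⊤⁺
  [ _ ] +⁺ ⊤⁺    = ⊤⁺

  _*⁺_ : ℕ → Cost → Cost
  k *⁺ [ x ] = [ fromℕ k * x ]
  k *⁺ ⊤⁺    = ⊤⁺

  sum⁺ : ∀ {m} → Vector Cost m → Cost
  sum⁺ = foldr _+⁺_ [ 0# ]

  IsSupremum : (Carrier → Carrier) → Cost → Set (c ⊔ ℓ₂)
  IsSupremum f s = (∀ t → [ f t ] ≤⁺ s) ×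
                   (∀ b → (∀ t → [ f t ] ≤⁺ b) → s ≤⁺ b)

  -- The elements are Fin n, and time starts at 0.

  record Request (n : ℕ) : Set (c ⊔ ℓ₁ ⊔ ℓ₂) where
    field
      element           : Fin n
      arrival           : Carrier
      delay             : Carrier → Carrier
      arrival-nonNeg    : 0# ≤ arrival
      delay-nonNeg      : ∀ t → 0# ≤ delay t
      delay-mono        : Monotonic₁ _≤_ _≤_ delay
      delay-upToArrival : ∀ t → t ≤ arrival → delay t ≈ 0#

  open Request

  Input : ℕ → ℕ → Set (c ⊔ ℓ₁ ⊔ ℓ₂)
  Input n m = Vector (Request n) m

  -- A list maps positions to elements; position zero is the head, so the
  -- 1-based position of p is rank p.

  Order : ℕ → Set
  Order n = Permutation′ n

  rank : ∀ {n} → Fin n → ℕ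
  rank p = suc (toℕ p)

  position : ∀ {n} → Order n → Fin n → Fin n
  position π e = π ⟨$⟩ˡ e

  -- swap i exchanges the elements in positions i and i + 1.
  data Action : ℕ → Set where
    access : ∀ {n} → Fin n → Action n
    swap   : ∀ {n} → Fin n → Action (suc n)

  actionCost : ∀ {n} → Action n → ℕ
  actionCost (access p) = rank p
  actionCost (swap _)   = 1

  -- A solution with infinitely many actions has infinite cost, so finite
  -- schedules suffice.
  Schedule : ℕ → Set c
  Schedule n = List (Carrier × Action n)

  Chronological : ∀ {n} → Schedule n → Set (c ⊔ ℓ₂)
  Chronological S = Linked _≤_ (0# ∷ map proj₁ S)

  reorder : ∀ {n} → Action n → Order n → Order n
  reorder (access _) π = π
  reorder (swap i)   π = transpose (inject₁ i) (suc i) ∘ₚ π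

  -- With ℓ = rank p, the position of 1-based index min (2ℓ, n).
  double : ∀ {n} → Fin n → Fin n
  double {suc n} p = fromℕ< (s≤s (ℕ.m⊓n≤n (suc (2 ℕ.* toℕ p)) n))

  rank-double : ∀ {n} (p : Fin n) → rank (double p) ≡ 2 ℕ.* rank p ⊓ n
  rank-double {suc n} p = ≡.trans
    (≡.cong suc (Fin.toℕ-fromℕ< (s≤s (ℕ.m⊓n≤n (suc (2 ℕ.* toℕ p)) n))))
    (≡.cong (_⊓ suc n) (≡.sym (ℕ.*-suc 2 (toℕ p))))

  -- The indices i - 1, …, 1, 0 below i.
  descending : ∀ {n} → Fin (suc n) → List (Fin n)
  descending         zero    = []
  descending {suc n} (suc i) = i ∷ map inject₁ (descending i)

  moveToFront : ∀ {n} → Fin n → List (Action n)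
  moveToFront {suc n} p = map swap (descending p)

  module _ {n m} (σ : Input n m) where

    record Configuration : Set c where
      constructor ⟨_,_⟩
      field
        order  : Order n
        served : Fin m → Maybe Carrier   -- time of service

    open Configuration public

    start : Order n → Configuration
    start π = ⟨ π , (λ _ → nothing) ⟩

    -- A request arriving at time t can be served by an access at time t.
    serve : Carrier → Action n → Configuration → Fin m → Maybe Carrier
    serve t (swap _)   C k = served C k
    serve t (access p) C k with served C k
    ... | just s  = just s
    ... | nothing with arrival (σ k) ≤? t
                     | position (order C) (element (σ k)) Fin.≤? p
    ...   | yes _ | yes _ = just t
    ...   | _     | _     = nothing

    perform : Configuration → Carrier × Action n → Configuration
    perform C (t , a) = ⟨ reorder a (order C) , serve t a C ⟩

    data IsDelayCost (D : Carrier → Carrier) : Maybe Carrier → Cost → Set (c ⊔ ℓ₂) where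
      servedAt    : ∀ s → IsDelayCost D (just s) [ D s ]
      neverServed : ∀ {d} → IsSupremum D d → IsDelayCost D nothing d

    -- A relation rather than a function, since a supremum cannot be computed.
    IsCost : Order n → Schedule n → Cost → Set (c ⊔ ℓ₂)
    IsCost π S C =
      ∃[ d ] (∀ k → IsDelayCost (delay (σ k)) (served final k) (d k)) ×
             C ≡ [ fromℕ actionTotal ] +⁺ sum⁺ d
      where
      final       = foldl perform (start π) S
      actionTotal = ℕ.sum (map (λ (_ , a) → actionCost a) S)

    IsOPT : Order n → Cost → Set (c ⊔ ℓ₂)
    IsOPT π opt =
      (∃[ S ] Chronological S × IsCost π S opt) ×
      (∀ S C → Chronological S → IsCost π S C → opt ≤⁺ C)

    record State : Set c where
      field
        time           : Carrier
        configuration  : Configuration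
        requestCounter : Vector Carrier m
        elementCounter : Vector Carrier n

    open State public

    -- Request counters that are not yet created or already deleted are 0, which
    -- leaves all sums of counters unchanged.  A deleted counter stays 0 because
    -- its request has been served.
    initial : Order n → State
    initial π = record
      { time           = 0#
      ; configuration  = start π
      ; requestCounter = λ _ → 0#
      ; elementCounter = λ _ → 0#
      }

    positionIn : State → Fin n → Fin n
    positionIn st e = position (order (configuration st)) e

    -- For a request that has not arrived by time t this is 0.
    delayIncurred : Carrier → State → Fin m → Carrier
    delayIncurred t st k with served (configuration st) k
    ... | just _  = 0#
    ... | nothing = delay (σ k) t - delay (σ k) (time st)

    wait : Carrier → State → State
    wait t st = record
      { time           = t
      ; configuration  = configuration st
      ; requestCounter = λ k → requestCounter st k + delayIncurred t st k
      ; elementCounter = λ e → elementCounter st e +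
          sum (λ k → if does (element (σ k) Fin.≟ e)
                     then delayIncurred t st k else 0#)
      }

    -- A prefix event is given by the last position of the prefix.
    data Event : Set where
      prefixEvent  : (p : Fin n) → Event
      elementEvent : (e : Fin n) → Event

    eventPosition : Event → State → Fin n
    eventPosition (prefixEvent p)  st = p
    eventPosition (elementEvent e) st = positionIn st e

    counter : Event → State → Carrier
    counter (prefixEvent p)  st =
      sum (λ k → if does (positionIn st (element (σ k)) Fin.≤? p)
                 then requestCounter st k else 0#)
    counter (elementEvent e) st = elementCounter st e

    threshold : Event → State → Carrier
    threshold ev st = fromℕ (rank (eventPosition ev st))

    Quiet : State → Set (ℓ₁ ⊔ ℓ₂)
    Quiet st = ∀ ev → counter ev st < threshold ev st

    -- No counter may have jumped past its threshold.  This is automatic for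
    -- continuous delay functions; if a delay function jumps past a threshold,
    -- the counter never reaches it and the run cannot be continued.
    Occurs : Event → State → Set (ℓ₁ ⊔ ℓ₂)
    Occurs ev st = counter ev st ≈ threshold ev st ×
                   (∀ ev′ → counter ev′ st ≤ threshold ev′ st)

    response : Event → State → List (Action n)
    response ev@(prefixEvent _)  st = access (double (eventPosition ev st)) ∷ []
    response ev@(elementEvent _) st = access (double (eventPosition ev st)) ∷
                                      moveToFront (eventPosition ev st)

    timedResponse : Event → State → Schedule n
    timedResponse ev st = map (time st ,_) (response ev st)

    deletes : Event → State → Fin m → Bool
    deletes (prefixEvent p)  st k = does (positionIn st (element (σ k)) Fin.≤? p)
    deletes (elementEvent e) st k = does (element (σ k) Fin.≟ e)

    resets : Event → Fin n → Bool
    resets (prefixEvent _)  e′ = false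
    resets (elementEvent e) e′ = does (e′ Fin.≟ e)

    handle : Event → State → State
    handle ev st = record
      { time           = time st
      ; configuration  = foldl perform (configuration st) (timedResponse ev st)
      ; requestCounter = λ k → if deletes ev st k then 0# else requestCounter st k
      ; elementCounter = λ e → if resets ev e then 0# else elementCounter st e
      }

    -- Several events may occur at the same time, in any order.  A counter that
    -- reaches its threshold is fed by requests that are served by then, which
    -- bounds the number of events by 2m: finite runs suffice.
    data Run (st : State) : Set (c ⊔ ℓ₁ ⊔ ℓ₂) where
      stop  : (∀ t → time st ≤ t → Quiet (wait t st)) → Run st
      event : ∀ t ev →
              time st ≤ t →
              (∀ s → time st ≤ s → s < t → Quiet (wait s st)) →
              Occurs ev (wait t st) →
              Run (handle ev (wait t st)) →
              Run st

    schedule : ∀ {st} → Run st → Schedule n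
    schedule      (stop _)             = []
    schedule {st} (event t ev _ _ _ r) = timedResponse ev (wait t st) ++ schedule r

    IsALG : Order n → Cost → Set (c ⊔ ℓ₁ ⊔ ℓ₂)
    IsALG π alg = ∃[ r ] IsCost π (schedule {initial π} r) alg

{-# OPTIONS --safe #-}
module Submission where

-- Every unit of delay raises one request counter and one element counter, and
-- these pay for the events, so ALG costs at most 6 times its own delay.
--
-- For the delay, let x and y be the ranks of an element in the lists of ALG and
-- OPT, I the number of elements before it in ALG's list but after it in OPT's,
-- E its element counter, and F the delay that ALG has yet to incur on those of
-- its requests that OPT has served.  With the potential
--
--   2I + min(3E, 4y ∸ x) + 3 min(F, 12y ∸ 2x) - E
--
-- summed over all elements, delay is free while the element is far (4y ≤ x).
-- While it is near, delay on requests served by OPT is paid from F, and delay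
-- on the other requests is paid by OPT's own delay.  When OPT accesses rank b,
-- F enters the potential only for elements with x < 6y ≤ 6b, and by the doubling
-- of the accessed prefixes ALG incurs at most 18b future delay on their requests.
-- So ALG's delay is at most 54 times OPT's cost, and its cost at most 324 times.
-- The term - E is kept on the other side of inequalities, to avoid subtraction.

open import Defs
import Algebra.Construct.NaturalChoice.Min as Min
import Algebra.Properties.CommutativeMonoid.Sum as Sum
import Algebra.Properties.Ring as RingProperties
import Algebra.Properties.Semiring.Mult as Mult
import Algebra.Solver.Ring as Solver
open import Algebra.Bundles using (RawRing)
open import Algebra.Solver.Ring.AlmostCommutativeRing
  using (_-Raw-AlmostCommutative⟶_; fromCommutativeSemiring)
open import Data.Bool.Base using (Bool; true; false; if_then_else_)
open import Data.Fin.Base as Fin using (Fin; zero; suc; toℕ; inject₁; fromℕ<)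
import Data.Fin.Properties as Fin
open import Data.Fin.Permutation
  using (Permutation′; transpose; _∘ₚ_; _⟨$⟩ˡ_; _⟨$⟩ʳ_; inverseˡ; inverseʳ)
import Data.Fin.Permutation.Components as PC
open import Data.List.Base using (List; []; _∷_; _++_; map; foldl; length; downFrom)
import Data.List.Properties as List
open import Data.List.Relation.Unary.All as All using (All; []; _∷_)
import Data.List.Relation.Unary.All.Properties as All
open import Data.List.Relation.Unary.Linked using (Linked; _∷_; [-])
open import Data.Maybe.Base as Maybe using (Maybe; just; nothing; maybe′; fromMaybe)
open import Data.Nat.Base as ℕ using (ℕ; zero; suc; z≤n; s≤s)
import Data.Nat.ListAction as ℕ
import Data.Nat.ListAction.Properties as ℕ
import Data.Nat.Properties as ℕ
open import Data.Nat.Solver using (module +-*-Solver)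
open import Data.Product.Base using (_×_; _,_; proj₁; proj₂; ∃-syntax)
open import Data.Sum.Base using (_⊎_; inj₁; inj₂; [_,_]′)
open import Data.Unit.Polymorphic.Base using (⊤; tt)
open import Data.Vec.Functional using (Vector)
open import Function.Base using (_∘_)
open import Level using (_⊔_)
open import Relation.Binary.Bundles using (TotalOrder)
open import Relation.Binary.Construct.Add.Supremum.NonStrict using ([_]; _≤⊤⁺; [≤]-injective)
open import Relation.Binary.Definitions using (Monotonic₁; tri<; tri≈; tri>)
open import Relation.Binary.PropositionalEquality.Core as ≡ using (_≡_; _≢_)
import Relation.Binary.Reasoning.PartialOrder as PartialOrderReasoning
open import Relation.Binary.Structures using (IsDecTotalOrder)
open import Relation.Nullary using (Dec; does; yes; no; ¬_; ¬?; contradiction)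
open import Relation.Nullary.Construct.Add.Supremum using ([_]; ⊤⁺)
open import Relation.Nullary.Decidable using (_×-dec_; dec-true; dec-false; dec⇒maybe)

-- The caps answer two opposite demands. When `e` is moved to the front, its I inversions disappear,
-- the J elements ahead of it in both lists may each gain one, and a counter E = x is reset; so
-- `2I + min(3x, 4y ∸ x)` has to cover `2J + x`, which follows from `I + J ≤ x ≤ I + y`. While x <
-- 4y, the term with F must really drop when F does, so its cap may not cut F off; as F ≤ x, the cap
-- `12y ∸ 2x` is large enough. It also vanishes from x = 6y on, and this keeps an access of OPT
-- affordable. That F ≤ x is the delicate point, because F speaks of ALG's future. A request served
-- by OPT has already arrived, so every later access of ALG that reaches its element serves it, and
-- its future delay has to pass through a request counter first, where the prefix thresholds bound
-- it. Since F depends on the future, the induction bounds what remains of a run, not what has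
-- accrued. A request that is never served may have infinite cost; therefore both solutions are
-- compared up to an arbitrary finite horizon T, and suprema are taken only at the end.

-- Ordered-field arithmetic and finite sums.

module Reals {c ℓ₁ ℓ₂} (ℝ : RealNumbers c ℓ₁ ℓ₂) where

  open RealNumbers ℝ hiding (sum; zero) public
  open IsDecTotalOrder isDecTotalOrder public
    using (isTotalOrder; ≤-respˡ-≈; ≤-respʳ-≈; total)
    renaming (refl to ≤-refl; trans to ≤-trans; reflexive to ≤-reflexive)
  open Sum +-commutativeMonoid public
    using (sum; ∑-distrib-+; ∑-comm; sum-cong-≋; sum-replicate-zero)

  totalOrder : TotalOrder c ℓ₁ ℓ₂
  totalOrder = record { isTotalOrder = isTotalOrder }

  open Min totalOrder public using (_⊓_; x⊓y≤x; x⊓y≤y; ⊓-glb; ⊓-mono-≤; ⊓-sel)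

  module ≤-Reasoning where
    open PartialOrderReasoning (TotalOrder.poset totalOrder) public hiding (start; stop)

  open Mult semiring public using (×-homo-+; ×1-homo-*)

  private
    -- Coefficients in `ℕ` let the solver treat constants such as 54 as literals. Negation is a
    -- placeholder: the target is a semiring with the identity as its negation, and genuine
    -- negatives enter the solver as atoms.
    ℕ-rawRing : RawRing _ _
    ℕ-rawRing = record
      { _≈_ = _≡_ ; _+_ = ℕ._+_ ; _*_ = ℕ._*_ ; -_ = λ k → k ; 0# = 0 ; 1# = 1 }

    fromℕ-homomorphism :
      ℕ-rawRing -Raw-AlmostCommutative⟶ fromCommutativeSemiring commutativeSemiring
    fromℕ-homomorphism = record
      { ⟦_⟧    = fromℕ
      ; +-homo = ×-homo-+ 1#
      ; *-homo = ×1-homo-*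
      ; -‿homo = λ _ → refl
      ; 0-homo = refl
      ; 1-homo = +-identityʳ 1#
      }

  open Solver ℕ-rawRing (fromCommutativeSemiring commutativeSemiring) fromℕ-homomorphism
    (λ j k → Maybe.map (λ j≡k → reflexive (≡.cong fromℕ j≡k))
               (dec⇒maybe (j ℕ.≟ k)))
    public using (solve; _:=_; _:+_; _:*_; con)

  infixl 7 _when_

  _when_ : Carrier → Bool → Carrier
  x when b = if b then x else 0#

  +-mono-≤ : ∀ {a b c d} → a ≤ b → c ≤ d → a + c ≤ b + d
  +-mono-≤ {a} {b} {c} {d} a≤b c≤d = begin
    a + c  ≤⟨ +-monoʳ-≤ a c≤d ⟩
    a + d  ≈⟨ +-comm a d ⟩
    d + a  ≤⟨ +-monoʳ-≤ d a≤b ⟩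
    d + b  ≈⟨ +-comm d b ⟩
    b + d  ∎
    where open ≤-Reasoning

  +-cancelʳ-≤ : ∀ {a b} c → a + c ≤ b + c → a ≤ b
  +-cancelʳ-≤ {a} {b} c a+c≤b+c = begin
    a              ≈⟨ cancel a ⟨
    - c + (a + c)  ≤⟨ +-monoʳ-≤ (- c) a+c≤b+c ⟩
    - c + (b + c)  ≈⟨ cancel b ⟩
    b              ∎
    where
    open ≤-Reasoning
    cancel : ∀ x → - c + (x + c) ≈ x
    cancel x = trans (solve 3 (λ m x c → m :+ (x :+ c) := x :+ (m :+ c)) refl (- c) x c)
      (trans (+-congˡ (-‿inverseˡ c)) (+-identityʳ x))

  -- Linear arithmetic without subtraction, leaving an identity to the solver.
  ≤-linear : ∀ {l r a b} → l ≤ r → a + r ≈ b + l → a ≤ b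
  ≤-linear {l} {r} {a} {b} l≤r eq = +-cancelʳ-≤ r (begin
    a + r  ≈⟨ eq ⟩
    b + l  ≤⟨ +-monoʳ-≤ b l≤r ⟩
    b + r  ∎)
    where open ≤-Reasoning

  0≤1 : 0# ≤ 1#
  0≤1 with total 0# 1#
  ... | inj₁ 0≤1 = 0≤1
  -- From `1 ≤ 0` follows `0 ≤ - 1`, and the square of `- 1` is 1.
  ... | inj₂ 1≤0 = ≤-respʳ-≈ (trans (-‿*-‿ ) (*-identityˡ 1#)) (*-nonNegative 0≤-1 0≤-1)
    where
    open RingProperties ring
    0≤-1 : 0# ≤ - 1#
    0≤-1 = +-cancelʳ-≤ 1# (≤-respˡ-≈ (sym (+-identityˡ 1#)) (≤-respʳ-≈ (sym (-‿inverseˡ 1#)) 1≤0))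
    -‿*-‿ : - 1# * - 1# ≈ 1# * 1#
    -‿*-‿ = trans (sym (-‿distribˡ-* 1# (- 1#))) (trans (-‿cong (sym (-‿distribʳ-* 1# 1#)))
        (-‿involutive _))

  +-nonNeg : ∀ {a b} → 0# ≤ a → 0# ≤ b → 0# ≤ a + b
  +-nonNeg 0≤a 0≤b = ≤-respˡ-≈ (+-identityˡ 0#) (+-mono-≤ 0≤a 0≤b)

  0≤fromℕ : ∀ k → 0# ≤ fromℕ k
  0≤fromℕ zero    = ≤-refl
  0≤fromℕ (suc k) = +-nonNeg 0≤1 (0≤fromℕ k)

  a≤a+b : ∀ a {b} → 0# ≤ b → a ≤ a + b
  a≤a+b a 0≤b = ≤-respˡ-≈ (+-identityʳ a) (+-monoʳ-≤ a 0≤b)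

  b≤a+b : ∀ {a} b → 0# ≤ a → b ≤ a + b
  b≤a+b {a} b 0≤a = ≤-respʳ-≈ (+-comm b a) (a≤a+b b 0≤a)

  fromℕ-+ : ∀ j k → fromℕ (j ℕ.+ k) ≈ fromℕ j + fromℕ k
  fromℕ-+ = ×-homo-+ 1#

  fromℕ-* : ∀ j k → fromℕ (j ℕ.* k) ≈ fromℕ j * fromℕ k
  fromℕ-* = ×1-homo-*

  fromℕ-mono : ∀ {j k} → j ℕ.≤ k → fromℕ j ≤ fromℕ k
  fromℕ-mono {k = k} z≤n = 0≤fromℕ k
  fromℕ-mono (s≤s j≤k)   = +-monoʳ-≤ 1# (fromℕ-mono j≤k)

  scale-mono : ∀ k {a b} → a ≤ b → fromℕ k * a ≤ fromℕ k * b
  scale-mono k {a} {b} a≤b = go k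
    where
    open ≤-Reasoning
    go : ∀ k → fromℕ k * a ≤ fromℕ k * b
    go zero    = ≤-reflexive (trans (zeroˡ a) (sym (zeroˡ b)))
    go (suc k) = begin
      (1# + fromℕ k) * a  ≈⟨ unfold a ⟩
      a + fromℕ k * a     ≤⟨ +-mono-≤ a≤b (go k) ⟩
      b + fromℕ k * b     ≈⟨ unfold b ⟨
      (1# + fromℕ k) * b  ∎
      where
      unfold : ∀ x → (1# + fromℕ k) * x ≈ x + fromℕ k * x
      unfold x = trans (distribʳ x 1# (fromℕ k)) (+-congʳ (*-identityˡ x))

  telescope : ∀ x y z → (y - x) + (z - y) ≈ z - x
  telescope x y z = trans
    (solve 4 (λ y z mx my → (y :+ mx) :+ (z :+ my) := (y :+ my) :+ (z :+ mx)) refl y z (- x) (- y))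
    (trans (+-congʳ (-‿inverseʳ y)) (+-identityˡ (z - x)))

  0≤y-x : ∀ {x y} → x ≤ y → 0# ≤ y - x
  0≤y-x {x} {y} x≤y = ≤-respˡ-≈ (-‿inverseˡ x)
    (≤-respʳ-≈ (+-comm (- x) y) (+-monoʳ-≤ (- x) x≤y))

  sum-mono : ∀ {k} {f g : Vector Carrier k} → (∀ i → f i ≤ g i) → sum f ≤ sum g
  sum-mono {zero}  f≤g = ≤-refl
  sum-mono {suc k} f≤g = +-mono-≤ (f≤g zero) (sum-mono (f≤g ∘ suc))

  sum-nonNeg : ∀ {k} {f : Vector Carrier k} → (∀ i → 0# ≤ f i) → 0# ≤ sum f
  sum-nonNeg {k} 0≤f = ≤-respˡ-≈ (sum-replicate-zero k) (sum-mono 0≤f)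

  sum-zero : ∀ {k} {f : Vector Carrier k} → (∀ i → f i ≈ 0#) → sum f ≈ 0#
  sum-zero {k} f≈0 = trans (sum-cong-≋ f≈0) (sum-replicate-zero k)

  sum-scale : ∀ {k} a (f : Vector Carrier k) → sum (λ i → a * f i) ≈ a * sum f
  sum-scale {zero}  a f = sym (zeroʳ a)
  sum-scale {suc k} a f = trans (+-congˡ (sum-scale a (f ∘ suc))) (sym (distribˡ a _ _))

  sum-fromℕ : ∀ {k} (f : Vector ℕ k) → fromℕ (Sum.sum ℕ.+-0-commutativeMonoid f) ≈ sum (fromℕ ∘ f)
  sum-fromℕ {zero}  f = refl
  sum-fromℕ {suc k} f = trans (fromℕ-+ (f zero) _) (+-congˡ (sum-fromℕ (f ∘ suc)))

  sum-single : ∀ {k} (f : Vector Carrier k) i →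
               sum (λ j → f j when does (i Fin.≟ j)) ≈ f i
  sum-single {suc k} f zero    = trans (+-congˡ (sum-zero {k} (λ _ → refl))) (+-identityʳ _)
  sum-single {suc k} f (suc i) = trans (+-identityˡ _) (sum-single (f ∘ suc) i)

  when-nonNeg : ∀ {x} b → 0# ≤ x → 0# ≤ x when b
  when-nonNeg true  0≤x = 0≤x
  when-nonNeg false 0≤x = ≤-refl

  when-distrib-+ : ∀ x y b → (x + y) when b ≈ x when b + y when b
  when-distrib-+ x y true  = refl
  when-distrib-+ x y false = sym (+-identityˡ 0#)

-- Counting elements by their positions in two lists.

module Inversions where

  open Sum ℕ.+-0-commutativeMonoid
  open import Data.Nat.Base using (_+_; _≤_; _<_)

  indicator : ∀ {a} {A : Set a} → Dec A → ℕ
  indicator A? = if does A? then 1 else 0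

  indicator-⊎ : ∀ {a b c} {A : Set a} {B : Set b} {C : Set c}
                (A? : Dec A) (B? : Dec B) (C? : Dec C) →
                (A → B ⊎ C) → indicator A? ≤ indicator B? + indicator C?
  indicator-⊎ (no _)  _       _       f = z≤n
  indicator-⊎ (yes _) (yes _) _       f = s≤s z≤n
  indicator-⊎ (yes a) (no ¬b) (yes _) f = s≤s z≤n
  indicator-⊎ (yes a) (no ¬b) (no ¬c) f with f a
  ... | inj₁ b = contradiction b ¬b
  ... | inj₂ c = contradiction c ¬c

  indicator-disjoint : ∀ {a b c} {A : Set a} {B : Set b} {C : Set c}
                       (A? : Dec A) (B? : Dec B) (C? : Dec C) →
                       (B → A) → (C → A) → ¬ (B × C) →
                       indicator B? + indicator C? ≤ indicator A?
  indicator-disjoint (yes _) (yes b) (yes c) f g h = contradiction (b , c) h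
  indicator-disjoint (yes _) (yes _) (no _)  f g h = s≤s z≤n
  indicator-disjoint (yes _) (no _)  (yes _) f g h = s≤s z≤n
  indicator-disjoint (yes _) (no _)  (no _)  f g h = z≤n
  indicator-disjoint (no ¬a) (yes b) _       f g h = contradiction (f b) ¬a
  indicator-disjoint (no ¬a) (no _)  (yes c) f g h = contradiction (g c) ¬a
  indicator-disjoint (no _)  (no _)  (no _)  f g h = z≤n

  sum-mono-ℕ : ∀ {n} {f g : Vector ℕ n} → (∀ i → f i ≤ g i) → sum f ≤ sum g
  sum-mono-ℕ {zero}  f≤g = z≤n
  sum-mono-ℕ {suc n} f≤g = ℕ.+-mono-≤ (f≤g zero) (sum-mono-ℕ (f≤g ∘ suc))

  count : ∀ {n p} {P : Fin n → Set p} → (∀ i → Dec (P i)) → ℕ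
  count P? = sum (λ i → indicator (P? i))

  count-⊎ : ∀ {n p q r} {P : Fin n → Set p} {Q : Fin n → Set q} {R : Fin n → Set r}
            (P? : ∀ i → Dec (P i)) (Q? : ∀ i → Dec (Q i)) (R? : ∀ i → Dec (R i)) →
            (∀ i → P i → Q i ⊎ R i) → count P? ≤ count Q? + count R?
  count-⊎ P? Q? R? f = ℕ.≤-trans
    (sum-mono-ℕ (λ i → indicator-⊎ (P? i) (Q? i) (R? i) (f i)))
    (ℕ.≤-reflexive (∑-distrib-+ (indicator ∘ Q?) (indicator ∘ R?)))

  count-disjoint : ∀ {n p q r} {P : Fin n → Set p} {Q : Fin n → Set q} {R : Fin n → Set r}
                   (P? : ∀ i → Dec (P i)) (Q? : ∀ i → Dec (Q i)) (R? : ∀ i → Dec (R i)) →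
                   (∀ i → Q i → P i) → (∀ i → R i → P i) → (∀ i → ¬ (Q i × R i)) →
                   count Q? + count R? ≤ count P?
  count-disjoint P? Q? R? f g h = ℕ.≤-trans
    (ℕ.≤-reflexive (≡.sym (∑-distrib-+ (indicator ∘ Q?) (indicator ∘ R?))))
    (sum-mono-ℕ (λ i → indicator-disjoint (P? i) (Q? i) (R? i) (f i) (g i) (h i)))

  count-mono : ∀ {n p q} {P : Fin n → Set p} {Q : Fin n → Set q}
               (P? : ∀ i → Dec (P i)) (Q? : ∀ i → Dec (Q i)) →
               (∀ i → P i → Q i) → count P? ≤ count Q?
  count-mono P? Q? f = sum-mono-ℕ (λ i → mono (P? i) (Q? i) (f i))
    where
    mono : ∀ {a b} {A : Set a} {B : Set b} (A? : Dec A) (B? : Dec B) →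
           (A → B) → indicator A? ≤ indicator B?
    mono (no _)  _       f = z≤n
    mono (yes _) (yes _) f = ℕ.≤-refl
    mono (yes a) (no ¬b) f = contradiction (f a) ¬b

  count-none : ∀ {n p} {P : Fin n → Set p} (P? : ∀ i → Dec (P i)) →
               (∀ i → ¬ P i) → count P? ≡ 0
  count-none {n} P? ¬P = ≡.trans
    (sum-cong-≗ {n} (λ i → ≡.cong (λ b → if b then 1 else 0) (dec-false (P? i) (¬P i))))
    (sum-replicate-zero n)

  count-toℕ< : ∀ {n} a → a ≤ n → count {n} (λ i → toℕ i ℕ.<? a) ≡ a
  count-toℕ< {n}     zero    a≤n       = sum-replicate-zero n
  count-toℕ< {suc n} (suc a) (s≤s a≤n) = ≡.cong suc (count-toℕ< a a≤n)

  pos : ∀ {n} → Permutation′ n → Fin n → ℕ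
  pos π e = toℕ (π ⟨$⟩ˡ e)

  pos-injective : ∀ {n} (π : Permutation′ n) {e f} → pos π e ≡ pos π f → e ≡ f
  pos-injective π {e} {f} eq = ≡.trans (≡.sym (inverseʳ π))
    (≡.trans (≡.cong (π ⟨$⟩ʳ_) (Fin.toℕ-injective eq)) (inverseʳ π))

  count-pos< : ∀ {n} (π : Permutation′ n) {a} → a ≤ n → count (λ e → pos π e ℕ.<? a) ≡ a
  count-pos< {n} π {a} a≤n = ≡.trans (sum-permute (λ e → indicator (pos π e ℕ.<? a)) π) (≡.trans
    (sum-cong-≗ {n} (λ i → ≡.cong (λ j → indicator (toℕ j ℕ.<? a)) (inverseˡ π {i})))
    (count-toℕ< a a≤n))

  -- A difference of known counts: the initial segments of lengths `suc a` and `a`, the shorter one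
  -- being disjoint from the elements at `a`.
  count-pos≡ : ∀ {n} (π : Permutation′ n) {a} → a < n → count (λ e → pos π e ℕ.≟ a) ≤ 1
  count-pos≡ π {a} a<n = ℕ.+-cancelʳ-≤ a _ 1 (ℕ.≤-trans
    (ℕ.≤-reflexive (≡.cong (count (λ e → pos π e ℕ.≟ a) +_) (≡.sym (count-pos< π (ℕ.<⇒≤ a<n)))))
    (ℕ.≤-trans
      (count-disjoint (λ e → pos π e ℕ.<? suc a) (λ e → pos π e ℕ.≟ a) (λ e → pos π e ℕ.<? a)
        (λ e eq → s≤s (ℕ.≤-reflexive eq)) (λ e lt → ℕ.m≤n⇒m≤1+n lt)
        (λ e (eq , lt) → ℕ.<-irrefl eq lt))
      (ℕ.≤-reflexive (count-pos< π a<n))))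

  count-pos≡-× : ∀ {n p} {P : Set p} (π : Permutation′ n) {a} → a < n → (P? : Dec P) →
                 count (λ e → (pos π e ℕ.≟ a) ×-dec P?) ≤ indicator P?
  count-pos≡-× π a<n (yes p) = ℕ.≤-trans
    (count-mono (λ e → (pos π e ℕ.≟ _) ×-dec yes p) (λ e → pos π e ℕ.≟ _) (λ _ → proj₁))
    (count-pos≡ π a<n)
  count-pos≡-× π a<n (no ¬p) = ℕ.≤-reflexive
    (count-none (λ e → (pos π e ℕ.≟ _) ×-dec no ¬p) (λ _ (_ , p) → ¬p p))

  inversion? : ∀ {n} (π ρ : Permutation′ n) e f →
               Dec (pos π f < pos π e × pos ρ e < pos ρ f)
  inversion? π ρ e f = (pos π f ℕ.<? pos π e) ×-dec (pos ρ e ℕ.<? pos ρ f)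

  agreement? : ∀ {n} (π ρ : Permutation′ n) e f →
               Dec (pos π f < pos π e × pos ρ f < pos ρ e)
  agreement? π ρ e f = (pos π f ℕ.<? pos π e) ×-dec (pos ρ f ℕ.<? pos ρ e)

  inversions agreements : ∀ {n} (π ρ : Permutation′ n) → Fin n → ℕ
  inversions π ρ e = count (inversion? π ρ e)
  agreements π ρ e = count (agreement? π ρ e)

  -- An element ahead of `e` in `π` is either behind it in `ρ`, hence an inversion, or one of the
  -- `pos ρ e` elements ahead of it there.
  pos≤inversions+pos : ∀ {n} (π ρ : Permutation′ n) e → pos π e ≤ inversions π ρ e + pos ρ e
  pos≤inversions+pos π ρ e = ≡.subst₂ _≤_
    (count-pos< π (ℕ.<⇒≤ (Fin.toℕ<n _)))
    (≡.cong (inversions π ρ e +_) (count-pos< ρ (ℕ.<⇒≤ (Fin.toℕ<n _))))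
    (count-⊎ (λ f → pos π f ℕ.<? pos π e) (inversion? π ρ e) (λ f → pos ρ f ℕ.<? pos ρ e) split)
    where
    split : ∀ f → pos π f < pos π e → (pos π f < pos π e × pos ρ e < pos ρ f) ⊎ pos ρ f < pos ρ e
    split f lt with ℕ.<-cmp (pos ρ f) (pos ρ e)
    ... | tri< lt′ _ _ = inj₂ lt′
    ... | tri≈ _ eq _  = contradiction lt (ℕ.<-irrefl (≡.cong (pos π) (pos-injective ρ eq)))
    ... | tri> _ _ gt  = inj₁ (lt , gt)

  rank≤inversions+rank : ∀ {n} (π ρ : Permutation′ n) e →
                         suc (pos π e) ≤ inversions π ρ e + suc (pos ρ e)
  rank≤inversions+rank π ρ e = ℕ.≤-trans (s≤s (pos≤inversions+pos π ρ e))
    (ℕ.≤-reflexive (≡.sym (ℕ.+-suc _ _)))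

  -- Both families consist of elements ahead of `e` in `π`, and they lie on opposite sides of `e` in
  -- `ρ`.
  inversions+agreements≤pos : ∀ {n} (π ρ : Permutation′ n) e →
                              inversions π ρ e + agreements π ρ e ≤ pos π e
  inversions+agreements≤pos π ρ e = ℕ.≤-trans
    (count-disjoint (λ f → pos π f ℕ.<? pos π e) (inversion? π ρ e) (agreement? π ρ e)
      (λ _ → proj₁) (λ _ → proj₁) (λ f ((_ , gt) , (_ , lt)) → ℕ.<-asym lt gt))
    (ℕ.≤-reflexive (count-pos< π (ℕ.<⇒≤ (Fin.toℕ<n _))))

  inversions-refl : ∀ {n} (π : Permutation′ n) e → inversions π π e ≡ 0
  inversions-refl π e = count-none (inversion? π π e) (λ _ (lt , gt) → ℕ.<-asym lt gt)

  -- The effect of an adjacent swap.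

  swapAdjacent : ℕ → ℕ → ℕ
  swapAdjacent zero    zero          = 1
  swapAdjacent zero    (suc zero)    = 0
  swapAdjacent zero    (suc (suc q)) = suc (suc q)
  swapAdjacent (suc i) zero          = zero
  swapAdjacent (suc i) (suc q)       = suc (swapAdjacent i q)

  swapAdjacent-lower : ∀ i → swapAdjacent i i ≡ suc i
  swapAdjacent-lower zero    = ≡.refl
  swapAdjacent-lower (suc i) = ≡.cong suc (swapAdjacent-lower i)

  swapAdjacent-upper : ∀ i → swapAdjacent i (suc i) ≡ i
  swapAdjacent-upper zero    = ≡.refl
  swapAdjacent-upper (suc i) = ≡.cong suc (swapAdjacent-upper i)

  swapAdjacent-other : ∀ i q → q ≢ i → q ≢ suc i → swapAdjacent i q ≡ q
  swapAdjacent-other zero    zero          q≢i q≢si = contradiction ≡.refl q≢i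
  swapAdjacent-other zero    (suc zero)    q≢i q≢si = contradiction ≡.refl q≢si
  swapAdjacent-other zero    (suc (suc q)) q≢i q≢si = ≡.refl
  swapAdjacent-other (suc i) zero          q≢i q≢si = ≡.refl
  swapAdjacent-other (suc i) (suc q)       q≢i q≢si =
    ≡.cong suc (swapAdjacent-other i q (q≢i ∘ ≡.cong suc) (q≢si ∘ ≡.cong suc))

  swapAdjacent-≤ : ∀ i q → swapAdjacent i q ≤ q + indicator (q ℕ.≟ i)
  swapAdjacent-≤ zero    zero          = s≤s z≤n
  swapAdjacent-≤ zero    (suc zero)    = z≤n
  swapAdjacent-≤ zero    (suc (suc q)) = ℕ.m≤m+n _ _
  swapAdjacent-≤ (suc i) zero          = z≤n
  swapAdjacent-≤ (suc i) (suc q)       = s≤s (swapAdjacent-≤ i q)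

  swapAdjacent-reflects-< : ∀ i p q → swapAdjacent i p < swapAdjacent i q →
                            p < q ⊎ (q ≡ i × p ≡ suc i)
  swapAdjacent-reflects-< zero    zero          zero          lt = contradiction lt (ℕ.<-irrefl ≡.refl)
  swapAdjacent-reflects-< zero    zero          (suc q)       lt = inj₁ (s≤s z≤n)
  swapAdjacent-reflects-< zero    (suc zero)    zero          lt = inj₂ (≡.refl , ≡.refl)
  swapAdjacent-reflects-< zero    (suc zero)    (suc (suc q)) lt = inj₁ (s≤s (s≤s z≤n))
  swapAdjacent-reflects-< zero    (suc (suc p)) zero          (s≤s ())
  swapAdjacent-reflects-< zero    (suc (suc p)) (suc (suc q)) lt = inj₁ lt
  swapAdjacent-reflects-< (suc i) zero          (suc q)       lt = inj₁ (s≤s z≤n)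
  swapAdjacent-reflects-< (suc i) (suc p)       (suc q)       (s≤s lt) with swapAdjacent-reflects-< i p q lt
  ... | inj₁ p<q         = inj₁ (s≤s p<q)
  ... | inj₂ (q≡i , p≡si) = inj₂ (≡.cong suc q≡i , ≡.cong suc p≡si)

  -- Positions are read through the inverse permutation, so the arguments of the transposition
  -- appear exchanged.
  toℕ-transpose : ∀ {n} (i : Fin n) q →
                  toℕ (PC.transpose (suc i) (inject₁ i) q) ≡ swapAdjacent (toℕ i) (toℕ q)
  toℕ-transpose i q with q Fin.≟ suc i
  ... | yes ≡.refl = ≡.trans (Fin.toℕ-inject₁ i) (≡.sym (swapAdjacent-upper (toℕ i)))
  ... | no q≢si with q Fin.≟ inject₁ i
  ...   | yes ≡.refl rewrite Fin.toℕ-inject₁ i = ≡.sym (swapAdjacent-lower (toℕ i))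
  ...   | no q≢i = ≡.sym (swapAdjacent-other (toℕ i) (toℕ q)
            (λ eq → q≢i (Fin.toℕ-injective (≡.trans eq (≡.sym (Fin.toℕ-inject₁ i)))))
            (λ eq → q≢si (Fin.toℕ-injective eq)))

  module _ {n} (ρ : Permutation′ (suc n)) (i : Fin n) where

    private
      ρ′ : Permutation′ (suc n)
      ρ′ = transpose (inject₁ i) (suc i) ∘ₚ ρ

    pos-swap : ∀ e → pos ρ′ e ≡ swapAdjacent (toℕ i) (pos ρ e)
    pos-swap e = toℕ-transpose i (ρ ⟨$⟩ˡ e)

    pos-swap-≤ : ∀ e → pos ρ′ e ≤ pos ρ e + indicator (pos ρ e ℕ.≟ toℕ i)
    pos-swap-≤ e = ℕ.≤-trans (ℕ.≤-reflexive (pos-swap e)) (swapAdjacent-≤ (toℕ i) (pos ρ e))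

    -- Only the pair in positions `i` and `i + 1` of `ρ` changes its relative order. The element
    -- that comes forward can gain one inversion, with the unique element that it overtakes.
    inversions-swap : ∀ π e → inversions π ρ′ e ≤
                              inversions π ρ e + indicator (pos ρ e ℕ.≟ suc (toℕ i))
    inversions-swap π e = ℕ.≤-trans
      (count-⊎ (inversion? π ρ′ e) (inversion? π ρ e)
        (λ f → (pos ρ f ℕ.≟ toℕ i) ×-dec (pos ρ e ℕ.≟ suc (toℕ i))) split)
      (ℕ.+-monoʳ-≤ (inversions π ρ e)
        (count-pos≡-× ρ (ℕ.m<n⇒m<1+n (Fin.toℕ<n i)) (pos ρ e ℕ.≟ suc (toℕ i))))
      where
      split : ∀ f → pos π f < pos π e × pos ρ′ e < pos ρ′ f →
              (pos π f < pos π e × pos ρ e < pos ρ f) ⊎ (pos ρ f ≡ toℕ i × pos ρ e ≡ suc (toℕ i))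
      split f (lt , gt) with swapAdjacent-reflects-< (toℕ i) (pos ρ e) (pos ρ f)
                               (≡.subst₂ _<_ (pos-swap e) (pos-swap f) gt)
      ... | inj₁ gt′ = inj₁ (lt , gt′)
      ... | inj₂ eqs = inj₂ eqs

  -- The effect of moving an element to the front.

  toFront : ℕ → ℕ → ℕ
  toFront zero    q = q
  toFront (suc p) q = toFront p (swapAdjacent p q)

  toFront-above : ∀ p q → p < q → toFront p q ≡ q
  toFront-above zero    q p<q = ≡.refl
  toFront-above (suc p) q p<q = ≡.trans
    (≡.cong (toFront p) (swapAdjacent-other p q
      (λ eq → ℕ.<-irrefl (≡.sym eq) (ℕ.<-trans (ℕ.n<1+n p) p<q)) (λ eq → ℕ.<-irrefl (≡.sym eq) p<q)))
    (toFront-above p q (ℕ.<-trans (ℕ.n<1+n p) p<q))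

  toFront-below : ∀ p q → q < p → toFront p q ≡ suc q
  toFront-below (suc p) q (s≤s q≤p) with q ℕ.≟ p
  ... | yes ≡.refl = ≡.trans (≡.cong (toFront q) (swapAdjacent-lower q)) (toFront-above q (suc q) ℕ.≤-refl)
  ... | no q≢p     = ≡.trans
    (≡.cong (toFront p) (swapAdjacent-other p q q≢p (λ eq → ℕ.<-irrefl eq (s≤s q≤p))))
    (toFront-below p q (ℕ.≤∧≢⇒< q≤p q≢p))

  toFront-self : ∀ p → toFront p p ≡ 0
  toFront-self zero    = ≡.refl
  toFront-self (suc p) = ≡.trans (≡.cong (toFront p) (swapAdjacent-upper p)) (toFront-self p)

  module _ {n} (π π′ : Permutation′ n) (e : Fin n)
           (moved : ∀ f → pos π′ f ≡ toFront (pos π e) (pos π f)) where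

    pos-moved≥ : ∀ f → f ≢ e → pos π f ≤ pos π′ f
    pos-moved≥ f f≢e with ℕ.<-cmp (pos π f) (pos π e)
    ... | tri< lt _ _ = ℕ.≤-trans (ℕ.n≤1+n _)
        (ℕ.≤-reflexive (≡.sym (≡.trans (moved f) (toFront-below _ _ lt))))
    ... | tri≈ _ eq _ = contradiction (pos-injective π eq) f≢e
    ... | tri> _ _ gt = ℕ.≤-reflexive (≡.sym (≡.trans (moved f) (toFront-above _ _ gt)))

    inversions-moved-self : ∀ ρ → inversions π′ ρ e ≡ 0
    inversions-moved-self ρ = count-none (inversion? π′ ρ e) (λ f (lt , _) →
      ℕ.n≮0 (≡.subst (_ <_) (≡.trans (moved e) (toFront-self (pos π e))) lt))

    -- Every pair reordered by the move contains `e`, so a new inversion of `f` can only be with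
    -- `e`, and then `e` was behind `f` in both lists. Summed over `f`, these indicators give
    -- `agreements π ρ e`.
    inversions-moved : ∀ ρ f → f ≢ e →
                       inversions π′ ρ f ≤ inversions π ρ f + indicator (agreement? π ρ e f)
    inversions-moved ρ f f≢e = ℕ.≤-trans
      (count-⊎ (inversion? π′ ρ f) (inversion? π ρ f)
        (λ g → (pos π g ℕ.≟ pos π e) ×-dec agreement? π ρ e f) split)
      (ℕ.+-monoʳ-≤ (inversions π ρ f)
        (count-pos≡-× π (Fin.toℕ<n _) (agreement? π ρ e f)))
      where
      below : ∀ {g} → pos π g < pos π e → pos π′ g ≡ suc (pos π g)
      below lt = ≡.trans (moved _) (toFront-below _ _ lt)
      above : ∀ {g} → pos π e < pos π g → pos π′ g ≡ pos π g
      above gt = ≡.trans (moved _) (toFront-above _ _ gt)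
      split : ∀ g → pos π′ g < pos π′ f × pos ρ f < pos ρ g →
              (pos π g < pos π f × pos ρ f < pos ρ g) ⊎
              (pos π g ≡ pos π e × pos π f < pos π e × pos ρ f < pos ρ e)
      split g (lt , gt) with ℕ.<-cmp (pos π g) (pos π e) | ℕ.<-cmp (pos π f) (pos π e)
      ... | _             | tri≈ _ f≈e _  = contradiction (pos-injective π f≈e) f≢e
      ... | tri≈ _ g≈e _  | tri< f<e _ _  =
        inj₂ (g≈e , f<e , ≡.subst (λ h → pos ρ f < pos ρ h) (pos-injective π g≈e) gt)
      ... | tri≈ _ g≈e _  | tri> _ _ f>e  = inj₁ (≡.subst (_< pos π f) (≡.sym g≈e) f>e , gt)
      ... | tri< g<e _ _  | tri< f<e _ _  =
        inj₁ (ℕ.s≤s⁻¹ (≡.subst₂ _<_ (below g<e) (below f<e) lt) , gt)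
      ... | tri< g<e _ _  | tri> _ _ f>e  = inj₁ (ℕ.<-trans g<e f>e , gt)
      ... | tri> _ _ g>e  | tri< f<e _ _  = contradiction
        (ℕ.<-≤-trans g>e (ℕ.s≤s⁻¹ (≡.subst₂ _<_ (above g>e) (below f<e) lt))) (ℕ.<-asym f<e)
      ... | tri> _ _ g>e  | tri> _ _ f>e  =
        inj₁ (≡.subst₂ _<_ (above g>e) (above f>e) lt , gt)

-- Integer inequalities behind the caps of the potential.

module NatBounds where

  open import Data.Nat.Base using (_+_; _*_; _∸_; _≤_)
  open ℕ.≤-Reasoning
  open +-*-Solver using (solve; con; _:*_; _:+_; _:=_)

  ∸-shift : ∀ k z y {y′} j → y′ ≤ y + j → k * y′ ∸ z ≤ (k * y ∸ z) + k * j
  ∸-shift k z y {y′} j y′≤y+j = ℕ.m≤n+o⇒m∸n≤o (k * y′) z (begin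
    k * y′                       ≤⟨ ℕ.*-monoʳ-≤ k y′≤y+j ⟩
    k * (y + j)                  ≡⟨ ℕ.*-distribˡ-+ k y j ⟩
    k * y + k * j                ≤⟨ ℕ.+-monoˡ-≤ (k * j) (ℕ.m≤n+m∸n (k * y) z) ⟩
    z + (k * y ∸ z) + k * j      ≡⟨ ℕ.+-assoc z _ _ ⟩
    z + ((k * y ∸ z) + k * j)    ∎)

  -- A rearrangement of `3 * x ≤ 12 * y`. It shows that for a near element a future delay of at most
  -- `x` stays below its cap.
  x≤12y∸2x : ∀ x y → x ≤ 4 * y → x ≤ 12 * y ∸ 2 * x
  x≤12y∸2x x y x≤4y = ℕ.m+n≤o⇒m≤o∸n x (ℕ.≤-trans (ℕ.*-monoʳ-≤ 3 x≤4y)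
    (ℕ.≤-reflexive (≡.sym (ℕ.*-assoc 3 4 y))))

  module _ I x y (x≤I+y : x ≤ I + y) where

    private
      u = 4 * y ∸ x

      -- Four times `x ≤ I + y` matches the coefficient of `y` in `u`. Truncation does no harm,
      -- because `u` enters only through `4 * y ≤ x + u`.
      3x≤4I+u : 3 * x ≤ 4 * I + u
      3x≤4I+u = ℕ.+-cancelˡ-≤ x _ _ (begin
        4 * x              ≤⟨ ℕ.*-monoʳ-≤ 4 x≤I+y ⟩
        4 * (I + y)        ≡⟨ ℕ.*-distribˡ-+ 4 I y ⟩
        4 * I + 4 * y      ≤⟨ ℕ.+-monoʳ-≤ (4 * I) (ℕ.m≤n+m∸n (4 * y) x) ⟩
        4 * I + (x + u)    ≡⟨ solve 3 (λ I x u → I :+ (x :+ u) := x :+ (I :+ u)) ≡.refl (4 * I) x u ⟩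
        x + (4 * I + u)    ∎)

    x≤2I+u : x ≤ 2 * I + u
    x≤2I+u = ℕ.*-cancelˡ-≤ 2 (begin
      2 * x              ≤⟨ ℕ.*-monoˡ-≤ x {2} {3} (s≤s (s≤s z≤n)) ⟩
      3 * x              ≤⟨ 3x≤4I+u ⟩
      4 * I + u          ≤⟨ ℕ.+-monoʳ-≤ (4 * I) (ℕ.m≤n*m u 2) ⟩
      4 * I + 2 * u      ≡⟨ solve 2 (λ I u → con 4 :* I :+ con 2 :* u := con 2 :* (con 2 :* I :+ u))
          ≡.refl I u ⟩
      2 * (2 * I + u)    ∎)

    -- With `I + J ≤ x`, adding `2 * I` makes the left side at most `3 * x`, which `4 * I + u`
    -- covers.
    2J+x≤2I+u : ∀ J → I + J ≤ x → 2 * J + x ≤ 2 * I + u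
    2J+x≤2I+u J I+J≤x = ℕ.+-cancelˡ-≤ (2 * I) _ _ (begin
      2 * I + (2 * J + x)    ≡⟨ solve 3 (λ I J x → con 2 :* I :+ (con 2 :* J :+ x) := con 2 :*
          (I :+ J) :+ x) ≡.refl I J x ⟩
      2 * (I + J) + x        ≤⟨ ℕ.+-monoˡ-≤ x (ℕ.*-monoʳ-≤ 2 I+J≤x) ⟩
      2 * x + x              ≡⟨ ℕ.+-comm (2 * x) x ⟩
      3 * x                  ≤⟨ 3x≤4I+u ⟩
      4 * I + u              ≡⟨ solve 2 (λ I u → con 4 :* I :+ u := con 2 :* I :+ (con 2 :* I :+ u))
          ≡.refl I u ⟩
      2 * I + (2 * I + u)    ∎)

  2J+x≤2I+3x : ∀ I J x → I + J ≤ x → 2 * J + x ≤ 2 * I + 3 * x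
  2J+x≤2I+3x I J x I+J≤x = begin
    2 * J + x        ≤⟨ ℕ.+-monoˡ-≤ x (ℕ.*-monoʳ-≤ 2 (ℕ.m+n≤o⇒n≤o I I+J≤x)) ⟩
    2 * x + x        ≡⟨ ℕ.+-comm (2 * x) x ⟩
    3 * x            ≤⟨ ℕ.m≤n+m (3 * x) (2 * I) ⟩
    2 * I + 3 * x    ∎

-- One summand of the potential under each kind of change.

module Potential {c ℓ₁ ℓ₂} (ℝ : RealNumbers c ℓ₁ ℓ₂) where

  open NatBounds
  open Reals ℝ

  ⊓-shiftʳ : ∀ a {v v′ d} → 0# ≤ d → v′ ≤ v + d → a ⊓ v′ ≤ a ⊓ v + d
  ⊓-shiftʳ a {v} {v′} {d} 0≤d v′≤v+d with ⊓-sel a v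
  ... | inj₁ eq = ≤-trans (x⊓y≤x a v′) (≤-respʳ-≈ (+-congʳ (sym eq)) (a≤a+b a 0≤d))
  ... | inj₂ eq = ≤-trans (x⊓y≤y a v′) (≤-respʳ-≈ (+-congʳ (sym eq)) v′≤v+d)

  ⊓-shiftˡ : ∀ {a a′ d} v → 0# ≤ d → a′ ≤ a + d → a′ ⊓ v ≤ a ⊓ v + d
  ⊓-shiftˡ {a} {a′} {d} v 0≤d a′≤a+d with ⊓-sel a v
  ... | inj₁ eq = ≤-trans (x⊓y≤x a′ v) (≤-respʳ-≈ (+-congʳ (sym eq)) a′≤a+d)
  ... | inj₂ eq = ≤-trans (x⊓y≤y a′ v) (≤-respʳ-≈ (+-congʳ (sym eq)) (a≤a+b v 0≤d))

  ≤-+-⊓ : ∀ {a b p q} → a ≤ b + p → a ≤ b + q → a ≤ b + p ⊓ q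
  ≤-+-⊓ {p = p} {q} a≤b+p a≤b+q with ⊓-sel p q
  ... | inj₁ eq = ≤-respʳ-≈ (+-congˡ (sym eq)) a≤b+p
  ... | inj₂ eq = ≤-respʳ-≈ (+-congˡ (sym eq)) a≤b+q

  fromℕ-≤-+ : ∀ {k} m l {r} → fromℕ l ≈ r → k ℕ.≤ m ℕ.+ l → fromℕ k ≤ fromℕ m + r
  fromℕ-≤-+ m l eq k≤m+l = ≤-respʳ-≈ (trans (fromℕ-+ m l) (+-congˡ eq)) (fromℕ-mono k≤m+l)

  -- A summand of the potential without the term - E.
  ψ : (I x y : ℕ) (E F : Carrier) → Carrier
  ψ I x y E F = fromℕ (2 ℕ.* I) + fromℕ 3 * E ⊓ fromℕ (4 ℕ.* y ℕ.∸ x)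
              + fromℕ 3 * (F ⊓ fromℕ (12 ℕ.* y ℕ.∸ 2 ℕ.* x))

  ψ-mono : ∀ {I I′ x x′ y y′ E E′ F F′} → I ℕ.≤ I′ → x′ ℕ.≤ x → y ℕ.≤ y′ →
           E ≤ E′ → F ≤ F′ → ψ I x y E F ≤ ψ I′ x′ y′ E′ F′
  ψ-mono I≤I′ x′≤x y≤y′ E≤E′ F≤F′ = +-mono-≤
    (+-mono-≤ (fromℕ-mono (ℕ.*-monoʳ-≤ 2 I≤I′))
      (⊓-mono-≤ (scale-mono 3 E≤E′) (fromℕ-mono (ℕ.∸-mono (ℕ.*-monoʳ-≤ 4 y≤y′) x′≤x))))
    (scale-mono 3 (⊓-mono-≤ F≤F′
      (fromℕ-mono (ℕ.∸-mono (ℕ.*-monoʳ-≤ 12 y≤y′) (ℕ.*-monoʳ-≤ 2 x′≤x)))))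

  ψ-monoʳ : ∀ I x y {E E′ F F′} → E ≤ E′ → F ≤ F′ → ψ I x y E F ≤ ψ I x y E′ F′
  ψ-monoʳ I x y = ψ-mono {I} {I} {x} {x} {y} {y} ℕ.≤-refl ℕ.≤-refl ℕ.≤-refl

  -- The increment `j` of `y` counts 4 times in the first cap and 3 times 12 in the second, hence
  -- 40. With `j = 0` the same estimate handles the inversions created when ALG moves an element to
  -- the front.
  ψ-swap : ∀ I I′ x y y′ i j E F → I′ ℕ.≤ I ℕ.+ i → y′ ℕ.≤ y ℕ.+ j →
           ψ I′ x y′ E F ≤ ψ I x y E F + (fromℕ 2 * fromℕ i + fromℕ 40 * fromℕ j)
  ψ-swap I I′ x y y′ i j E F I′≤I+i y′≤y+j = begin
    ψ I′ x y′ E F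
      ≤⟨ +-mono-≤
           (+-mono-≤ (fromℕ-≤-+ (2 ℕ.* I) (2 ℕ.* i) (fromℕ-* 2 i) 2I′≤2I+2i)
                     (⊓-shiftʳ (fromℕ 3 * E) (0≤ 4) (fromℕ-≤-+ (4 ℕ.* y ℕ.∸ x) (4 ℕ.* j)
                         (fromℕ-* 4 j) (∸-shift 4 x y j y′≤y+j))))
           (scale-mono 3 (⊓-shiftʳ F (0≤ 12) (fromℕ-≤-+ (12 ℕ.* y ℕ.∸ 2 ℕ.* x) (12 ℕ.* j)
               (fromℕ-* 12 j) (∸-shift 12 (2 ℕ.* x) y j y′≤y+j)))) ⟩
    (fromℕ (2 ℕ.* I) + fromℕ 2 * fromℕ i) + (T + fromℕ 4 * fromℕ j) + fromℕ 3 * (W + fromℕ 12 * fromℕ j)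
      ≈⟨ solve 5 (λ I T W i j →
           (I :+ con 2 :* i) :+ (T :+ con 4 :* j) :+ con 3 :* (W :+ con 12 :* j) :=
           (I :+ T :+ con 3 :* W) :+ (con 2 :* i :+ con 40 :* j)) refl
           (fromℕ (2 ℕ.* I)) T W (fromℕ i) (fromℕ j) ⟩
    ψ I x y E F + (fromℕ 2 * fromℕ i + fromℕ 40 * fromℕ j) ∎
    where
    open ≤-Reasoning
    T = fromℕ 3 * E ⊓ fromℕ (4 ℕ.* y ℕ.∸ x)
    W = F ⊓ fromℕ (12 ℕ.* y ℕ.∸ 2 ℕ.* x)
    0≤ : ∀ k → 0# ≤ fromℕ k * fromℕ j
    0≤ k = ≤-respʳ-≈ (fromℕ-* k j) (0≤fromℕ (k ℕ.* j))
    2I′≤2I+2i : 2 ℕ.* I′ ℕ.≤ 2 ℕ.* I ℕ.+ 2 ℕ.* i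
    2I′≤2I+2i = ℕ.≤-trans (ℕ.*-monoʳ-≤ 2 I′≤I+i) (ℕ.≤-reflexive (ℕ.*-distribˡ-+ 2 I i))

  -- The cap `12 * y ∸ 2 * x` is zero exactly when the element is not near, and an increase of `F`
  -- then has no effect.
  ψ-access : ∀ I x y E {F g} (near? : Dec (x ℕ.< 6 ℕ.* y)) → 0# ≤ F → 0# ≤ g →
             ψ I x y E (F + g) ≤ ψ I x y E F + fromℕ 3 * (g when does near?)
  ψ-access I x y E {F} {g} (yes _) 0≤F 0≤g = begin
    A + fromℕ 3 * ((F + g) ⊓ v)    ≤⟨ +-monoʳ-≤ A (scale-mono 3 (⊓-shiftˡ v 0≤g ≤-refl)) ⟩
    A + fromℕ 3 * (F ⊓ v + g)      ≈⟨ solve 3 (λ A W g → A :+ con 3 :* (W :+ g) := A :+ con 3 :* W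
        :+ con 3 :* g) refl A (F ⊓ v) g ⟩
    A + fromℕ 3 * (F ⊓ v) + fromℕ 3 * g ∎
    where
    open ≤-Reasoning
    A = fromℕ (2 ℕ.* I) + fromℕ 3 * E ⊓ fromℕ (4 ℕ.* y ℕ.∸ x)
    v = fromℕ (12 ℕ.* y ℕ.∸ 2 ℕ.* x)
  ψ-access I x y E {F} {g} (no x≮6y) 0≤F 0≤g = ≤-respʳ-≈
      (sym (trans (+-congˡ (zeroʳ _)) (+-identityʳ _))) (+-monoʳ-≤ A (scale-mono 3 (≤-trans (x⊓y≤y _ _)
      (⊓-glb (≤-respˡ-≈ (reflexive (≡.sym (≡.cong fromℕ v≡0))) 0≤F) ≤-refl))))
    where
    A = fromℕ (2 ℕ.* I) + fromℕ 3 * E ⊓ fromℕ (4 ℕ.* y ℕ.∸ x)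
    v≡0 : 12 ℕ.* y ℕ.∸ 2 ℕ.* x ≡ 0
    v≡0 = ℕ.m≤n⇒m∸n≡0 (ℕ.≤-trans (ℕ.≤-reflexive (ℕ.*-assoc 2 6 y)) (ℕ.*-monoʳ-≤ 2 (ℕ.≮⇒≥ x≮6y)))

  -- Here `a` stands for delay charged to OPT and `b` for delay on requests that OPT has served: `b`
  -- leaves `F` as it enters `E`.
  ψ-wait : ∀ I x y {E F a b} → 0# ≤ E → 0# ≤ a → 0# ≤ b → F + b ≤ fromℕ x →
           ψ I x y (E + (a + b)) F ≤ ψ I x y E (F + b) + fromℕ 3 * a
  ψ-wait I x y {E} {F} {a} {b} 0≤E 0≤a 0≤b F+b≤x with 4 ℕ.* y ℕ.≤? x
  -- The cap `u` is 0, so the growth of `E` is invisible.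
  ... | yes 4y≤x = begin
    fromℕ (2 ℕ.* I) + (fromℕ 3 * (E + (a + b))) ⊓ u + fromℕ 3 * (F ⊓ v)
      ≤⟨ +-mono-≤ (+-monoʳ-≤ _ (≤-trans (x⊓y≤y _ u)
          (⊓-glb (≤-respˡ-≈ (reflexive (≡.sym (≡.cong fromℕ (ℕ.m≤n⇒m∸n≡0 4y≤x)))) (0≤3* 0≤E)) ≤-refl)))
                  (scale-mono 3 (⊓-mono-≤ (a≤a+b F 0≤b) ≤-refl)) ⟩
    ψ I x y E (F + b) ≤⟨ a≤a+b _ (0≤3* 0≤a) ⟩
    ψ I x y E (F + b) + fromℕ 3 * a ∎
    where
    open ≤-Reasoning
    u = fromℕ (4 ℕ.* y ℕ.∸ x)
    v = fromℕ (12 ℕ.* y ℕ.∸ 2 ℕ.* x)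
    0≤3* : ∀ {z} → 0# ≤ z → 0# ≤ fromℕ 3 * z
    0≤3* 0≤z = *-nonNegative (0≤fromℕ 3) 0≤z
  -- Now `F + b ≤ x` is below the cap `v`, so the term with `F` really gives up `3 * b`, which
  -- balances the part of the growth of `3 * E` due to `b`.
  ... | no 4y≰x = begin
    fromℕ (2 ℕ.* I) + (fromℕ 3 * (E + (a + b))) ⊓ u + fromℕ 3 * (F ⊓ v)
      ≤⟨ +-mono-≤ (+-monoʳ-≤ _ (⊓-shiftˡ u (*-nonNegative (0≤fromℕ 3) (+-nonNeg 0≤a 0≤b))
           (≤-reflexive (distribˡ (fromℕ 3) E (a + b))))) ≤-refl ⟩
    fromℕ (2 ℕ.* I) + (T + fromℕ 3 * (a + b)) + fromℕ 3 * (F ⊓ v)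
      ≈⟨ solve 5 (λ I T W a b → I :+ (T :+ con 3 :* (a :+ b)) :+ con 3 :* W :=
                                I :+ T :+ con 3 :* (W :+ b) :+ con 3 :* a) refl
           (fromℕ (2 ℕ.* I)) T (F ⊓ v) a b ⟩
    fromℕ (2 ℕ.* I) + T + fromℕ 3 * (F ⊓ v + b) + fromℕ 3 * a
      ≤⟨ +-mono-≤ (+-monoʳ-≤ _ (scale-mono 3 (⊓-glb
           (+-mono-≤ (x⊓y≤x F v) ≤-refl)
           (≤-trans (+-mono-≤ (x⊓y≤x F v) ≤-refl)
               (≤-trans F+b≤x (fromℕ-mono (x≤12y∸2x x y (ℕ.<⇒≤ (ℕ.≰⇒> 4y≰x))))))))) ≤-refl ⟩
    ψ I x y E (F + b) + fromℕ 3 * a ∎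
    where
    open ≤-Reasoning
    u = fromℕ (4 ℕ.* y ℕ.∸ x)
    v = fromℕ (12 ℕ.* y ℕ.∸ 2 ℕ.* x)
    T = (fromℕ 3 * E) ⊓ u

  -- What an element event releases: weight 2 for each of `J` new inversions elsewhere, and `x` for
  -- the counter that is reset. Each argument of the minimum covers this by itself.
  ψ-event : ∀ I J x y {F} → x ℕ.≤ I ℕ.+ y → I ℕ.+ J ℕ.≤ x → 0# ≤ F →
            fromℕ (2 ℕ.* J ℕ.+ x) ≤ ψ I x y (fromℕ x) F
  ψ-event I J x y x≤I+y I+J≤x 0≤F = ≤-trans
    (≤-+-⊓ (fromℕ-≤-+ (2 ℕ.* I) (3 ℕ.* x) (fromℕ-* 3 x) (2J+x≤2I+3x I J x I+J≤x))
           (fromℕ-≤-+ (2 ℕ.* I) (4 ℕ.* y ℕ.∸ x) refl (2J+x≤2I+u I x y x≤I+y J I+J≤x)))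
    (a≤a+b _ (*-nonNegative (0≤fromℕ 3) (⊓-glb 0≤F (0≤fromℕ (12 ℕ.* y ℕ.∸ 2 ℕ.* x)))))

  -- Nonnegativity of a full summand, with `E` kept on the left. Against the first argument of the
  -- minimum `E ≤ 3 * E` suffices, against the second `E ≤ x ≤ 2 * I + u`.
  E≤ψ : ∀ I x y {E F} → x ℕ.≤ I ℕ.+ y → 0# ≤ E → E ≤ fromℕ x → 0# ≤ F → E ≤ ψ I x y E F
  E≤ψ I x y {E} {F} x≤I+y 0≤E E≤x 0≤F = ≤-trans
    (≤-+-⊓ (≤-linear (+-nonNeg (0≤fromℕ (2 ℕ.* I)) (*-nonNegative (0≤fromℕ 2) 0≤E))
             (solve 2 (λ E I → E :+ (I :+ con 2 :* E) := I :+ con 3 :* E :+ con 0) refl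
               E (fromℕ (2 ℕ.* I))))
           (≤-trans E≤x (fromℕ-≤-+ (2 ℕ.* I) (4 ℕ.* y ℕ.∸ x) refl (x≤2I+u I x y x≤I+y))))
    (a≤a+b _ (*-nonNegative (0≤fromℕ 3) (⊓-glb 0≤F (0≤fromℕ (12 ℕ.* y ℕ.∸ 2 ℕ.* x)))))

  ψ-zero : ∀ x y → ψ 0 x y 0# 0# ≤ 0#
  ψ-zero x y = begin
    0# + (fromℕ 3 * 0#) ⊓ fromℕ (4 ℕ.* y ℕ.∸ x) + fromℕ 3 * (0# ⊓ fromℕ (12 ℕ.* y ℕ.∸ 2 ℕ.* x))
      ≤⟨ +-mono-≤ (+-monoʳ-≤ 0# (x⊓y≤x (fromℕ 3 * 0#) _)) (scale-mono 3 (x⊓y≤x 0# _)) ⟩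
    0# + fromℕ 3 * 0# + fromℕ 3 * 0#
      ≈⟨ solve 0 (con 0 :+ con 3 :* con 0 :+ con 3 :* con 0 := con 0) refl ⟩
    0# ∎
    where open ≤-Reasoning

-- Service, future delay and list order along a schedule.

module Dynamics {c ℓ₁ ℓ₂} (ℝ : RealNumbers c ℓ₁ ℓ₂) where

  open Reals ℝ
  open ListUpdate ℝ
  open Request
  open Inversions using (pos; swapAdjacent; toFront; pos-swap; toFront-above)

  module _ {n m} (σ : Input n m) where

    serve-just : ∀ {s} t a (C : Configuration σ) k → served C k ≡ just s → serve σ t a C k ≡ just s
    serve-just t (swap _)   C k eq = eq
    serve-just t (access p) C k eq rewrite eq = ≡.refl

    serve-nothing : ∀ t a (C : Configuration σ) k → served C k ≡ nothing →
                    serve σ t a C k ≡ nothing ⊎ serve σ t a C k ≡ just t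
    serve-nothing t (swap _)   C k eq = inj₁ eq
    serve-nothing t (access p) C k eq rewrite eq
      with arrival (σ k) ≤? t | position (order C) (element (σ k)) Fin.≤? p
    ... | yes _ | yes _ = inj₂ ≡.refl
    ... | yes _ | no _  = inj₁ ≡.refl
    ... | no _  | yes _ = inj₁ ≡.refl
    ... | no _  | no _  = inj₁ ≡.refl

    serve-access : ∀ t p (C : Configuration σ) k → arrival (σ k) ≤ t →
                   position (order C) (element (σ k)) Fin.≤ p →
                   ∃[ s ] serve σ t (access p) C k ≡ just s
    serve-access t p C k arrived reached with served C k
    ... | just s  = s , ≡.refl
    ... | nothing with arrival (σ k) ≤? t | position (order C) (element (σ k)) Fin.≤? p
    ...   | yes _   | yes _     = t , ≡.refl
    ...   | yes _   | no ¬reach = contradiction reached ¬reach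
    ...   | no ¬arr | yes _     = contradiction arrived ¬arr
    ...   | no ¬arr | no _      = contradiction arrived ¬arr

    serve-access⁻¹ : ∀ {s} t p (C : Configuration σ) k → served C k ≡ nothing →
                     serve σ t (access p) C k ≡ just s →
                     arrival (σ k) ≤ t × position (order C) (element (σ k)) Fin.≤ p
    serve-access⁻¹ t p C k eq eq′ rewrite eq
      with arrival (σ k) ≤? t | position (order C) (element (σ k)) Fin.≤? p
    ... | yes arrived | yes reached = arrived , reached
    serve-access⁻¹ t p C k eq () | yes _ | no _
    serve-access⁻¹ t p C k eq () | no _  | yes _
    serve-access⁻¹ t p C k eq () | no _  | no _

    served-foldl : ∀ {s} S (C : Configuration σ) k → served C k ≡ just s →
                   served (foldl (perform σ) C S) k ≡ just s
    served-foldl []            C k eq = eq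
    served-foldl ((t , a) ∷ S) C k eq = served-foldl S (perform σ C (t , a)) k (serve-just t a C k eq)

    -- Unlike `delayIncurred`, this allows any starting time, so intervals can be split, and it
    -- applies to configurations of OPT too.
    incurred : Configuration σ → Carrier → Carrier → Fin m → Carrier
    incurred C s t k = maybe′ (λ _ → 0#) (delay (σ k) t - delay (σ k) s) (served C k)

    incurred-nonNeg : ∀ C {s t} k → s ≤ t → 0# ≤ incurred C s t k
    incurred-nonNeg C k s≤t with served C k
    ... | just _  = ≤-refl
    ... | nothing = 0≤y-x (delay-mono (σ k) s≤t)

    incurred-refl : ∀ C t k → incurred C t t k ≈ 0#
    incurred-refl C t k with served C k
    ... | just _  = refl
    ... | nothing = -‿inverseʳ _

    incurred-+ : ∀ C s t u k → incurred C s t k + incurred C t u k ≈ incurred C s u k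
    incurred-+ C s t u k with served C k
    ... | just _  = +-identityˡ 0#
    ... | nothing = telescope _ _ _

    delayIncurred≡incurred : ∀ t st k →
      delayIncurred σ t st k ≡ incurred (configuration st) (time st) t k
    delayIncurred≡incurred t st k with served (configuration st) k
    ... | just _  = ≡.refl
    ... | nothing = ≡.refl

    module _ (T : Carrier) where

      -- Requests that are never served are cut off at the horizon T.
      serviceTime : Configuration σ → Fin m → Carrier
      serviceTime C k = fromMaybe T (served C k)

      -- Delay to come after `t`, read off the remaining schedule `S`. It is used for both
      -- solutions, for ALG with the schedule of its run.
      due : Configuration σ → Schedule n → Carrier → Fin m → Carrier
      due C S t k = maybe′ (λ _ → 0#)
        (delay (σ k) (serviceTime (foldl (perform σ) C S) k) - delay (σ k) t) (served C k)

      due-served : ∀ C S t k {s} → served C k ≡ just s → due C S t k ≡ 0#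
      due-served C S t k eq rewrite eq = ≡.refl

      due-wait : ∀ C S s t k → due C S s k ≈ incurred C s t k + due C S t k
      due-wait C S s t k with served C k
      ... | just _  = sym (+-identityˡ 0#)
      ... | nothing = sym (telescope _ _ _)

      due-horizon : ∀ C k → due C [] T k ≈ 0#
      due-horizon C k with served C k
      ... | just _  = refl
      ... | nothing = -‿inverseʳ _

      -- A request served by this very action has service time `t`, so no delay is left on either
      -- side; for all others the action changes nothing.
      due-perform : ∀ C t a S k → due C ((t , a) ∷ S) t k ≈ due (perform σ C (t , a)) S t k
      due-perform C t a S k with served C k in eq
      ... | just s  rewrite serve-just t a C k eq = refl
      ... | nothing with serve-nothing t a C k eq
      ...   | inj₁ eq′ rewrite eq′ = refl
      ...   | inj₂ eq′ rewrite served-foldl S (perform σ C (t , a)) k eq′ | eq′ = -‿inverseʳ _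

      due-block : ∀ C t as S k →
        due C (map (t ,_) as ++ S) t k ≈ due (foldl (perform σ) C (map (t ,_) as)) S t k
      due-block C t []       S k = refl
      due-block C t (a ∷ as) S k = trans (due-perform C t a (map (t ,_) as ++ S) k)
        (due-block (perform σ C (t , a)) t as S k)

  foldl-downFrom : ∀ p q → foldl (λ r i → swapAdjacent i r) q (downFrom p) ≡ toFront p q
  foldl-downFrom zero    q = ≡.refl
  foldl-downFrom (suc p) q = foldl-downFrom p (swapAdjacent p q)

  toℕ-descending : ∀ {n} (p : Fin (suc n)) → map toℕ (descending p) ≡ downFrom (toℕ p)
  toℕ-descending         zero    = ≡.refl
  toℕ-descending {suc n} (suc i) = ≡.cong (toℕ i ∷_) (≡.trans
    (≡.sym (List.map-∘ (descending i)))
    (≡.trans (List.map-cong Fin.toℕ-inject₁ (descending i)) (toℕ-descending i)))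

  module _ {n m} (σ : Input (suc n) m) (t : Carrier) where

    pos-swaps : ∀ is C e → pos (order (foldl (perform σ) C (map (t ,_) (map swap is)))) e ≡
                           foldl (λ q i → swapAdjacent (toℕ i) q) (pos (order C) e) is
    pos-swaps []       C e = ≡.refl
    pos-swaps (i ∷ is) C e = ≡.trans (pos-swaps is (perform σ C (t , swap i)) e)
      (≡.cong (λ q → foldl (λ q i → swapAdjacent (toℕ i) q) q is) (pos-swap (order C) i e))

    served-swaps : ∀ is C k → served (foldl (perform σ) C (map (t ,_) (map swap is))) k ≡ served C k
    served-swaps []       C k = ≡.refl
    served-swaps (i ∷ is) C k = served-swaps is (perform σ C (t , swap i)) k

  pos-moveToFront : ∀ {n m} (σ : Input n m) t p C e →
    pos (order (foldl (perform σ) C (map (t ,_) (moveToFront p)))) e ≡ toFront (toℕ p) (pos (order C) e)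
  pos-moveToFront {suc n} σ t p C e = ≡.trans (pos-swaps σ t (descending p) C e) (≡.trans
    (≡.sym (List.foldl-map (λ r i → swapAdjacent i r) toℕ _ (descending p)))
    (≡.trans (≡.cong (foldl (λ r i → swapAdjacent i r) _) (toℕ-descending p))
      (foldl-downFrom (toℕ p) _)))

  served-moveToFront : ∀ {n m} (σ : Input n m) t p C k →
    served (foldl (perform σ) C (map (t ,_) (moveToFront p))) k ≡ served C k
  served-moveToFront {suc n} σ t p C k = served-swaps σ t (descending p) C k

  actionsCost : ∀ {n} → List (Action n) → ℕ
  actionsCost as = ℕ.sum (map actionCost as)

  moveToFront-cost : ∀ {n} (p : Fin n) → actionsCost (moveToFront p) ≡ toℕ p
  moveToFront-cost {suc n} p = ≡.trans (count (descending p)) (≡.trans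
    (≡.sym (List.length-map toℕ (descending p)))
    (≡.trans (≡.cong length (toℕ-descending p)) (List.length-downFrom (toℕ p))))
    where
    count : ∀ is → actionsCost (map swap is) ≡ length is
    count []       = ≡.refl
    count (i ∷ is) = ≡.cong suc (count is)

  module _ {n m} (σ : Input n m) (s : State σ) where

    served-handle : ∀ ev k → arrival (σ k) ≤ time s →
                    positionIn σ s (element (σ k)) Fin.≤ double (eventPosition σ ev s) →
                    ∃[ x ] served (configuration (handle σ ev s)) k ≡ just x
    served-handle ev@(prefixEvent p)  k arrived reached =
      serve-access σ (time s) _ (configuration s) k arrived reached
    served-handle ev@(elementEvent e) k arrived reached
      with serve-access σ (time s) _ (configuration s) k arrived reached
    ... | x , eq = x , ≡.trans (served-moveToFront σ (time s) (positionIn σ s e) _ k) eq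

    pos-element : ∀ e f → pos (order (configuration (handle σ (elementEvent e) s))) f ≡
                          toFront (pos (order (configuration s)) e) (pos (order (configuration s)) f)
    pos-element e f = pos-moveToFront σ (time s) (positionIn σ s e) _ f

    -- Moving an element to the front permutes only the positions up to its own.
    pos-handle : ∀ ev e → eventPosition σ ev s Fin.< positionIn σ s e →
                 pos (order (configuration (handle σ ev s))) e ≡ pos (order (configuration s)) e
    pos-handle (prefixEvent p)  e lt = ≡.refl
    pos-handle (elementEvent f) e lt = ≡.trans (pos-element f e) (toFront-above _ _ lt)

    requestCounter-handle : ∀ ev k → eventPosition σ ev s Fin.< positionIn σ s (element (σ k)) →
                            requestCounter (handle σ ev s) k ≡ requestCounter s k
    requestCounter-handle ev k lt = ≡.cong (λ b → if b then 0# else requestCounter s k) (kept ev lt)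
      where
      kept : ∀ ev → eventPosition σ ev s Fin.< positionIn σ s (element (σ k)) → deletes σ ev s k ≡ false
      kept (prefixEvent p)  lt = dec-false (positionIn σ s (element (σ k)) Fin.≤? p) (ℕ.<⇒≱ lt)
      kept (elementEvent e) lt = dec-false (element (σ k) Fin.≟ e)
        (λ eq → ℕ.<-irrefl (≡.cong (λ f → toℕ (positionIn σ s f)) (≡.sym eq)) lt)

-- Bounding the future delay of ALG.

module Online {c ℓ₁ ℓ₂} (ℝ : RealNumbers c ℓ₁ ℓ₂) where

  open Reals ℝ
  open ListUpdate ℝ
  open Request
  open Dynamics ℝ

  when-≤-dec : ∀ {a} {A : Set a} {x z} (A? : Dec A) → (A → x ≤ z) → 0# ≤ z → x when does A? ≤ z
  when-≤-dec (yes a) f 0≤z = f a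
  when-≤-dec (no _)  f 0≤z = 0≤z

  ≤-when-dec : ∀ {a} {A : Set a} {x z} (A? : Dec A) → A → x ≤ z → x ≤ z when does A?
  ≤-when-dec (yes _) a x≤z = x≤z
  ≤-when-dec (no ¬a) a x≤z = contradiction a ¬a

  when-zero-dec : ∀ {a} {A : Set a} {x} (A? : Dec A) → (A → x ≈ 0#) → x when does A? ≈ 0#
  when-zero-dec (yes a) f = f a
  when-zero-dec (no _)  f = refl

  sum-fibres : ∀ {m n} (g : Fin m → Fin n) (f : Vector Carrier m) →
               sum (λ e → sum (λ k → f k when does (g k Fin.≟ e))) ≈ sum f
  sum-fibres {m} {n} g f = trans (∑-comm (λ e k → f k when does (g k Fin.≟ e)))
    (sum-cong-≋ {m} (λ k → sum-single (λ _ → f k) (g k)))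

  rank-double-≤ : ∀ {n} (q : Fin n) → rank (double q) ℕ.≤ 2 ℕ.* rank q
  rank-double-≤ q = ℕ.≤-trans (ℕ.≤-reflexive (rank-double q)) (ℕ.m⊓n≤m _ _)

  ≤-double : ∀ {n} (q : Fin n) → q Fin.≤ double q
  ≤-double {n} q = ℕ.s≤s⁻¹ (ℕ.≤-trans (ℕ.⊓-glb (ℕ.m≤n*m (rank q) 2) (Fin.toℕ<n q))
      (ℕ.≤-reflexive (≡.sym (rank-double q))))

  -- The existence of a position beyond `double q` rules out truncation at `n`, so the doubling is
  -- exact.
  rank-double-< : ∀ {n} (q p : Fin n) → double q Fin.< p → rank (double q) ≡ 2 ℕ.* rank q
  rank-double-< {n} q p P<p = ≡.trans (rank-double q) (ℕ.m≤n⇒m⊓n≡m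
    (ℕ.≮⇒≥ λ n<2q → ℕ.<⇒≱ (Fin.toℕ<n p) (ℕ.≤-trans
      (ℕ.≤-reflexive (≡.sym (≡.trans (rank-double q) (ℕ.m≥n⇒m⊓n≡n (ℕ.<⇒≤ n<2q))))) P<p)))

  scheduleCost : ∀ {n} → Schedule n → ℕ
  scheduleCost S = ℕ.sum (map (λ (_ , a) → actionCost a) S)

  scheduleCost-++ : ∀ {n} (S S′ : Schedule n) → scheduleCost (S ++ S′) ≡ scheduleCost S ℕ.+ scheduleCost S′
  scheduleCost-++ S S′ = ≡.trans (≡.cong ℕ.sum (List.map-++ _ S S′)) (ℕ.sum-++ (map _ S) _)

  scheduleCost-timed : ∀ {n} t (as : List (Action n)) → scheduleCost (map (t ,_) as) ≡ actionsCost as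
  scheduleCost-timed t as = ≡.cong ℕ.sum (≡.sym (List.map-∘ as))

  module _ {n m} (σ : Input n m) where

    elementOf : Fin m → Fin n
    elementOf k = element (σ k)

    -- Time `τ` does not pass the next event; once no event remains it is unrestricted.
    Until : ∀ {st} → Run σ st → Carrier → Set ℓ₂
    Until (stop _)            τ = ⊤
    Until (event t _ _ _ _ _) τ = τ ≤ t

    Until-start : ∀ {st} (r : Run σ st) → Until r (time st)
    Until-start (stop _)             = tt
    Until-start (event _ _ t≥ _ _ _) = t≥

    record NonNegative (st : State σ) : Set ℓ₂ where
      field
        requests : ∀ k → 0# ≤ requestCounter st k
        elements : ∀ e → 0# ≤ elementCounter st e

    open NonNegative public

    delayIncurred-nonNeg : ∀ {t} st k → time st ≤ t → 0# ≤ delayIncurred σ t st k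
    delayIncurred-nonNeg {t} st k st≤t =
      ≡.subst (0# ≤_) (≡.sym (delayIncurred≡incurred σ t st k))
          (incurred-nonNeg σ (configuration st) k st≤t)

    wait-nonNegative : ∀ {st t} → NonNegative st → time st ≤ t → NonNegative (wait σ t st)
    wait-nonNegative {st} {t} valid st≤t = record
      { requests = λ k → +-nonNeg (requests valid k) (delayIncurred-nonNeg st k st≤t)
      ; elements = λ e → +-nonNeg (elements valid e) (sum-nonNeg {m} (λ k →
          when-nonNeg (does (elementOf k Fin.≟ e)) (delayIncurred-nonNeg st k st≤t)))
      }

    handle-nonNegative : ∀ {st} ev → NonNegative st → NonNegative (handle σ ev st)
    handle-nonNegative {st} ev valid = record
      { requests = λ k → erase (deletes σ ev st k) (requests valid k)
      ; elements = λ e → erase (resets σ ev e) (elements valid e)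
      }
      where
      erase : ∀ {x} b → 0# ≤ x → 0# ≤ (if b then 0# else x)
      erase true  0≤x = ≤-refl
      erase false 0≤x = 0≤x

    wait-requestCounters : ∀ t st →
      sum (requestCounter (wait σ t st)) ≈ sum (requestCounter st) + sum (delayIncurred σ t st)
    wait-requestCounters t st = ∑-distrib-+ (requestCounter st) (delayIncurred σ t st)

    wait-elementCounters : ∀ t st →
      sum (elementCounter (wait σ t st)) ≈ sum (elementCounter st) + sum (delayIncurred σ t st)
    wait-elementCounters t st = trans
      (∑-distrib-+ (elementCounter st) (λ e → sum (λ k → delayIncurred σ t st k when does
          (elementOf k Fin.≟ e))))
      (+-congˡ (sum-fibres elementOf (delayIncurred σ t st)))

    reset-elementCounters : ∀ e s →
      sum (elementCounter s) ≈ sum (elementCounter (handle σ (elementEvent e) s)) + elementCounter s e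
    reset-elementCounters e s = trans (sum-cong-≋ {n} split) (trans
      (∑-distrib-+ (elementCounter (handle σ (elementEvent e) s)) (λ f → elementCounter s f when
          does (e Fin.≟ f)))
      (+-congˡ (sum-single (elementCounter s) e)))
      where
      split : ∀ f → elementCounter s f ≈ elementCounter (handle σ (elementEvent e) s) f +
                                         elementCounter s f when does (e Fin.≟ f)
      split f with f Fin.≟ e | e Fin.≟ f
      ... | yes _   | yes _   = sym (+-identityˡ _)
      ... | no _    | no _    = sym (+-identityʳ _)
      ... | yes f≡e | no e≢f  = contradiction (≡.sym f≡e) e≢f
      ... | no f≢e  | yes e≡f = contradiction (≡.sym e≡f) f≢e

    module _ (T : Carrier) where

      Bounded : Schedule n → Set _
      Bounded = All (λ (t , _) → t ≤ T)

      event-≤T : ∀ ev st → Bounded (timedResponse σ ev st) → time st ≤ T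
      event-≤T (prefixEvent _)  st (t≤T ∷ _) = t≤T
      event-≤T (elementEvent _) st (t≤T ∷ _) = t≤T

      -- The remaining run is an argument, since it is what supplies the future service times.
      fut : ∀ {st} → Run σ st → Carrier → Fin m → Carrier
      fut {st} r τ k = due σ T (configuration st) (schedule σ r) τ k

      fut-event : ∀ {st} t ev t≥ quiet occ (r : Run σ (handle σ ev (wait σ t st))) k →
                  fut {st} (event t ev t≥ quiet occ r) t k ≈ fut r t k
      fut-event {st} t ev t≥ quiet occ r k =
        due-block σ T (configuration st) t (response σ ev (wait σ t st)) (schedule σ r) k

      fut-stop : ∀ {st} quiet τ k → fut {st} (stop quiet) τ k ≈ incurred σ (configuration st) τ T k
      fut-stop {st} quiet τ k = trans (due-wait σ T (configuration st) [] τ T k)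
        (trans (+-congˡ (due-horizon σ T (configuration st) k)) (+-identityʳ _))

      fut-nonNeg : ∀ {st} (r : Run σ st) τ → Bounded (schedule σ r) → τ ≤ T → Until r τ →
                   ∀ k → 0# ≤ fut r τ k
      fut-nonNeg {st} (stop quiet) τ bnd τ≤T _ k =
        ≤-respʳ-≈ (sym (fut-stop quiet τ k)) (incurred-nonNeg σ (configuration st) k τ≤T)
      fut-nonNeg {st} r@(event t ev t≥ quiet occ r′) τ bnd τ≤T τ≤t k =
        ≤-respʳ-≈ (sym (trans (due-wait σ T (configuration st) (schedule σ r) τ t k)
            (+-congˡ (fut-event t ev t≥ quiet occ r′ k))))
          (+-nonNeg (incurred-nonNeg σ (configuration st) k τ≤t)
            (fut-nonNeg r′ t (All.++⁻ʳ (timedResponse σ ev (wait σ t st)) bnd)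
              (event-≤T ev (wait σ t st) (All.++⁻ˡ _ bnd)) (Until-start r′) k))

      -- Invariant under waiting: delay moves from fut to the counter.
      load : ∀ {st} → Run σ st → Fin m → Carrier
      load {st} r k = requestCounter st k + fut r (time st) k

      load-stop : ∀ {st} quiet k → load {st} (stop quiet) k ≈ requestCounter (wait σ T st) k
      load-stop {st} quiet k = +-congˡ (trans (fut-stop quiet (time st) k)
        (reflexive (≡.sym (delayIncurred≡incurred σ T st k))))

      load-event : ∀ {st} t ev t≥ quiet occ (r : Run σ (handle σ ev (wait σ t st))) k →
                    load {st} (event t ev t≥ quiet occ r) k ≈ requestCounter (wait σ t st) k + fut r t k
      load-event {st} t ev t≥ quiet occ r k = trans
        (+-congˡ (trans (due-wait σ T (configuration st) (timedResponse σ ev (wait σ t st) ++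
            schedule σ r) (time st) t k)
          (+-cong (reflexive (≡.sym (delayIncurred≡incurred σ t st k))) (fut-event t ev t≥ quiet occ r k))))
        (sym (+-assoc _ _ _))

      fut≤load : ∀ {st} (r : Run σ st) τ → NonNegative st → time st ≤ τ → ∀ k → fut r τ k ≤ load r k
      fut≤load {st} r τ valid st≤τ k = begin
        fut r τ k                                                     ≤⟨ a≤a+b _
            (+-nonNeg (requests valid k) (incurred-nonNeg σ (configuration st) k st≤τ)) ⟩
        fut r τ k + (requestCounter st k + incurred σ (configuration st) (time st) τ k)
          ≈⟨ solve 3 (λ f r i → f :+ (r :+ i) := r :+ (i :+ f)) refl (fut r τ k) (requestCounter st k) _ ⟩
        requestCounter st k + (incurred σ (configuration st) (time st) τ k + fut r τ k)
          ≈⟨ +-congˡ (due-wait σ T (configuration st) (schedule σ r) (time st) τ k) ⟨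
        load r k ∎
        where open ≤-Reasoning

      inRange? : ∀ (st : State σ) L (p : Fin n) k → Dec (L ℕ.≤ toℕ (positionIn σ st (elementOf k)) ×
          positionIn σ st (elementOf k) Fin.≤ p)
      inRange? st L p k = (L ℕ.≤? _) ×-dec (positionIn σ st (elementOf k) Fin.≤? p)

      module _ {s} {Selected : Fin m → Set s} (selected? : ∀ k → Dec (Selected k)) where

        -- In the applications, selected requests have been served by OPT. They have arrived, so
        -- each later access of ALG that reaches their position serves them.
        rangeLoad : ∀ {st} → Run σ st → ℕ → Fin n → Carrier
        rangeLoad {st} r L p = sum (λ k → load r k when does (selected? k ×-dec inRange? st L p k))

        -- An event at a rank above L serves twice that prefix.  If this does not
        -- reach p, then the counters in the served part are at most its length,
        -- and the requests beyond it are untouched: L at least doubles.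
        rangeLoad-bound : ∀ {st} (r : Run σ st) τ → (∀ k → Selected k → arrival (σ k) ≤ τ) → Until r τ →
          NonNegative st → Bounded (schedule σ r) → time st ≤ T →
          ∀ L p → L ℕ.≤ toℕ p → rangeLoad r L p + fromℕ (2 ℕ.* L) ≤ fromℕ (rank p ℕ.+ 2 ℕ.* toℕ p)
        -- The state is still quiet at `T`, so the prefix counter of `p` bounds the whole load.
        rangeLoad-bound {st} r@(stop quiet) τ arrived until valid bnd st≤T L p L≤p = begin
          rangeLoad r L p + fromℕ (2 ℕ.* L)
            ≤⟨ +-mono-≤ (≤-trans (sum-mono {m} pointwise) (proj₁ (quiet T st≤T (prefixEvent p))))
                (fromℕ-mono (ℕ.*-monoʳ-≤ 2 L≤p)) ⟩
          fromℕ (rank p) + fromℕ (2 ℕ.* toℕ p)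
            ≈⟨ fromℕ-+ (rank p) (2 ℕ.* toℕ p) ⟨
          fromℕ (rank p ℕ.+ 2 ℕ.* toℕ p) ∎
          where
          open ≤-Reasoning
          s′ = wait σ T st
          pointwise : ∀ k → load r k when does (selected? k ×-dec inRange? st L p k) ≤
                            requestCounter s′ k when does (positionIn σ s′ (elementOf k) Fin.≤? p)
          pointwise k = when-≤-dec (selected? k ×-dec inRange? st L p k)
            (λ (_ , _ , pos≤p) → ≤-when-dec (positionIn σ s′ (elementOf k) Fin.≤? p) pos≤p
              (≤-reflexive (load-stop quiet k)))
            (when-nonNeg (does (positionIn σ s′ (elementOf k) Fin.≤? p))
                (requests (wait-nonNegative valid st≤T) k))
        rangeLoad-bound {st} r@(event t ev t≥ quiet occ r′) τ arrived τ≤t valid bnd st≤T L p L≤p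
          = bound
          where
          open ≤-Reasoning
          s′ = wait σ t st
          s″ = handle σ ev s′
          q = eventPosition σ ev s′
          valid′ = wait-nonNegative valid t≥
          valid″ = handle-nonNegative ev valid′
          bnd′ = All.++⁻ʳ (timedResponse σ ev s′) bnd
          t≤T = event-≤T ev s′ (All.++⁻ˡ _ bnd)

          posIn : Fin m → Fin n
          posIn k = positionIn σ s′ (elementOf k)

          IH : ∀ L → L ℕ.≤ toℕ p → rangeLoad r′ L p + fromℕ (2 ℕ.* L) ≤ fromℕ (rank p ℕ.+ 2 ℕ.* toℕ p)
          IH L = rangeLoad-bound r′ t (λ k sel → ≤-trans (arrived k sel) τ≤t) (Until-start r′)
              valid″ bnd′ t≤T L p

          load′-nonNeg : ∀ k → 0# ≤ load r′ k
          load′-nonNeg k = +-nonNeg (requests valid″ k) (fut-nonNeg r′ t bnd′ t≤T (Until-start r′) k)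

          beyond : ∀ k L → Selected k → q Fin.< posIn k → L ℕ.≤ toℕ (posIn k) → posIn k Fin.≤ p →
                   load r k ≤ load r′ k when does (selected? k ×-dec inRange? s″ L p k)
          beyond k L sel q<pos L≤pos pos≤p = ≤-when-dec (selected? k ×-dec inRange? s″ L p k)
            (sel , ≡.subst (L ℕ.≤_) (≡.sym same) L≤pos , ≡.subst (ℕ._≤ toℕ p) (≡.sym same) pos≤p)
            (≤-reflexive (trans (load-event t ev t≥ quiet occ r′ k)
              (+-congʳ (reflexive (≡.sym (requestCounter-handle σ s′ ev k q<pos))))))
            where
            same : toℕ (positionIn σ s″ (elementOf k)) ≡ toℕ (posIn k)
            same = pos-handle σ s′ ev (elementOf k) q<pos

          -- The access serves the request, no future delay remains, and the load is the counter
          -- alone.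
          within : ∀ k → Selected k → posIn k Fin.≤ double q → load r k ≤ requestCounter s′ k
          within k sel pos≤P = ≤-reflexive (trans (load-event t ev t≥ quiet occ r′ k)
            (trans (+-congˡ (reflexive (due-served σ T (configuration s″) (schedule σ r′) t k
              (proj₂ (served-handle σ s′ ev k (≤-trans (arrived k sel) τ≤t) pos≤P)))))
            (+-identityʳ _)))

          prefix-nonNeg : ∀ k (p : Fin n) → 0# ≤ requestCounter s′ k when does (posIn k Fin.≤? p)
          prefix-nonNeg k p = when-nonNeg (does (posIn k Fin.≤? p)) (requests valid′ k)

          bound : rangeLoad r L p + fromℕ (2 ℕ.* L) ≤ fromℕ (rank p ℕ.+ 2 ℕ.* toℕ p)
          bound with toℕ q ℕ.<? L
          -- Positions and counters from `L` on are untouched by an event below `L`, so the load is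
          -- the same before and after it.
          ... | yes q<L = ≤-trans (+-mono-≤ (sum-mono {m} (λ k →
            when-≤-dec (selected? k ×-dec inRange? st L p k)
              (λ (sel , L≤pos , pos≤p) → beyond k L sel (ℕ.<-≤-trans q<L L≤pos) L≤pos pos≤p)
              (when-nonNeg (does (selected? k ×-dec inRange? s″ L p k)) (load′-nonNeg k)))) ≤-refl)
                  (IH L L≤p)
          ... | no q≮L with p Fin.≤? double q
          -- The whole range is served at once, and the prefix counter of `p` has not passed its
          -- threshold.
          ...   | yes p≤P = begin
            rangeLoad r L p + fromℕ (2 ℕ.* L)
              ≤⟨ +-mono-≤ (≤-trans (sum-mono {m} (λ k → when-≤-dec (selected? k ×-dec inRange? st L p k)
                   (λ (sel , _ , pos≤p) → ≤-when-dec (posIn k Fin.≤? p) pos≤p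
                       (within k sel (ℕ.≤-trans pos≤p p≤P))) (prefix-nonNeg k p)))
                   (proj₂ occ (prefixEvent p))) (fromℕ-mono (ℕ.*-monoʳ-≤ 2 L≤p)) ⟩
            fromℕ (rank p) + fromℕ (2 ℕ.* toℕ p)  ≈⟨ fromℕ-+ (rank p) (2 ℕ.* toℕ p) ⟨
            fromℕ (rank p ℕ.+ 2 ℕ.* toℕ p)        ∎
          -- The term `2 * L` acts as a potential: the served part costs `L′`, and `2 * L` is at
          -- most `L′`, which together supply the `2 * L′` of the induction hypothesis.
          ...   | no p≰P = begin
            rangeLoad r L p + fromℕ (2 ℕ.* L)
              ≤⟨ +-mono-≤ (≤-trans (sum-mono {m} pointwise)
                   (≤-trans (≤-reflexive (∑-distrib-+ (λ k → requestCounter s′ k when does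
                       (posIn k Fin.≤? P)) _))
                     (+-mono-≤ (proj₂ occ (prefixEvent P)) ≤-refl))) (fromℕ-mono 2L≤L′) ⟩
            (fromℕ L′ + rangeLoad r′ L′ p) + fromℕ L′
              ≈⟨ solve 2 (λ l r → (l :+ r) :+ l := r :+ con 2 :* l) refl (fromℕ L′) (rangeLoad r′ L′ p) ⟩
            rangeLoad r′ L′ p + fromℕ 2 * fromℕ L′
              ≈⟨ +-congˡ (fromℕ-* 2 L′) ⟨
            rangeLoad r′ L′ p + fromℕ (2 ℕ.* L′)
              ≤⟨ IH L′ (ℕ.≰⇒> p≰P) ⟩
            fromℕ (rank p ℕ.+ 2 ℕ.* toℕ p) ∎
            where
            P = double q
            L′ = rank P
            2L≤L′ : 2 ℕ.* L ℕ.≤ L′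
            2L≤L′ = ℕ.≤-trans (ℕ.*-monoʳ-≤ 2 (ℕ.m≤n⇒m≤1+n (ℕ.≮⇒≥ q≮L)))
              (ℕ.≤-reflexive (≡.sym (rank-double-< q p (ℕ.≰⇒> p≰P))))
            pointwise : ∀ k → load r k when does (selected? k ×-dec inRange? st L p k) ≤
                              requestCounter s′ k when does (posIn k Fin.≤? P) +
                              load r′ k when does (selected? k ×-dec inRange? s″ L′ p k)
            pointwise k = when-≤-dec (selected? k ×-dec inRange? st L p k)
              (λ (sel , _ , pos≤p) → split sel pos≤p (posIn k Fin.≤? P))
              (+-nonNeg (prefix-nonNeg k P) 0≤load′)
              where
              0≤load′ = when-nonNeg (does (selected? k ×-dec inRange? s″ L′ p k)) (load′-nonNeg k)
              split : Selected k → posIn k Fin.≤ p → Dec (posIn k Fin.≤ P) →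
                      load r k ≤ requestCounter s′ k when does (posIn k Fin.≤? P) +
                                 load r′ k when does (selected? k ×-dec inRange? s″ L′ p k)
              split sel pos≤p (yes pos≤P) =
                ≤-trans (≤-when-dec (posIn k Fin.≤? P) pos≤P (within k sel pos≤P)) (a≤a+b _ 0≤load′)
              split sel pos≤p (no pos≰P)  = ≤-trans
                (beyond k L′ sel (ℕ.≤-<-trans (≤-double q) (ℕ.≰⇒> pos≰P)) (ℕ.≰⇒> pos≰P) pos≤p)
                (b≤a+b _ (prefix-nonNeg k P))

-- Consequences for single elements and prefixes, and the cost of ALG's actions.

module Accounts {c ℓ₁ ℓ₂} (ℝ : RealNumbers c ℓ₁ ℓ₂) where

  open Reals ℝ
  open ListUpdate ℝ
  open Request
  open Dynamics ℝ
  open Online ℝ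

  module _ {n m} (σ : Input n m) (T : Carrier) where

    module _ {st} (r : Run σ st) τ (st≤τ : time st ≤ τ) (until : Until σ r τ) (τ≤T : τ ≤ T)
             (valid : NonNegative σ st) (bnd : Bounded σ T (schedule σ r))
             {s} {Selected : Fin m → Set s} (selected? : ∀ k → Dec (Selected k))
             (arrived : ∀ k → Selected k → arrival (σ k) ≤ τ) where

      private
        load-nonNeg : ∀ k → 0# ≤ load σ T r k
        load-nonNeg k = +-nonNeg (requests valid k)
          (fut-nonNeg σ T r (time st) bnd (≤-trans st≤τ τ≤T) (Until-start σ r) k)

        st≤T : time st ≤ T
        st≤T = ≤-trans st≤τ τ≤T

      -- With `L` at the position of `e` the range is a single position, and `2 * L` cancels all but
      -- `rank p` of the bound.
      fut-element-≤ : ∀ e → sum (λ k → fut σ T r τ k when does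
          (selected? k ×-dec (elementOf σ k Fin.≟ e))) ≤
                            fromℕ (rank (positionIn σ st e))
      fut-element-≤ e = +-cancelʳ-≤ (fromℕ (2 ℕ.* toℕ p)) (begin
        sum (λ k → fut σ T r τ k when does (sel? k)) + fromℕ (2 ℕ.* toℕ p)
          ≤⟨ +-mono-≤ (sum-mono {m} (λ k → when-≤-dec (sel? k)
               (λ (sel , el≡e) → ≤-when-dec (sel? k ×-dec inRange? σ T st (toℕ p) p k)
                 ((sel , el≡e) , ℕ.≤-reflexive (≡.cong (toℕ ∘ positionIn σ st) (≡.sym el≡e))
                               , ℕ.≤-reflexive (≡.cong (toℕ ∘ positionIn σ st) el≡e))
                 (fut≤load σ T r τ valid st≤τ k))
               (when-nonNeg (does (sel? k ×-dec inRange? σ T st (toℕ p) p k)) (load-nonNeg k)))) ≤-refl ⟩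
        rangeLoad σ T sel? r (toℕ p) p + fromℕ (2 ℕ.* toℕ p)
          ≤⟨ rangeLoad-bound σ T sel? r τ (λ k (sel , _) → arrived k sel) until valid bnd st≤T
              (toℕ p) p ℕ.≤-refl ⟩
        fromℕ (rank p ℕ.+ 2 ℕ.* toℕ p)
          ≈⟨ fromℕ-+ (rank p) (2 ℕ.* toℕ p) ⟩
        fromℕ (rank p) + fromℕ (2 ℕ.* toℕ p) ∎)
        where
        open ≤-Reasoning
        p = positionIn σ st e
        sel? = λ k → selected? k ×-dec (elementOf σ k Fin.≟ e)

      -- The case `L = 0`. The successively served prefixes at least double in length, so they
      -- contribute a geometric sum, whence the factor 3.
      fut-prefix-≤ : ∀ p → sum (λ k → fut σ T r τ k when does
          (selected? k ×-dec (positionIn σ st (elementOf σ k) Fin.≤? p))) ≤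
                           fromℕ (3 ℕ.* rank p)
      fut-prefix-≤ p = begin
        sum (λ k → fut σ T r τ k when does (sel? k))
          ≤⟨ sum-mono {m} (λ k → when-≤-dec (sel? k)
               (λ (sel , pos≤p) → ≤-when-dec (selected? k ×-dec inRange? σ T st 0 p k) (sel , z≤n , pos≤p)
                 (fut≤load σ T r τ valid st≤τ k))
               (when-nonNeg (does (selected? k ×-dec inRange? σ T st 0 p k)) (load-nonNeg k))) ⟩
        rangeLoad σ T selected? r 0 p
          ≈⟨ +-identityʳ _ ⟨
        rangeLoad σ T selected? r 0 p + fromℕ 0
          ≤⟨ rangeLoad-bound σ T selected? r τ arrived until valid bnd st≤T 0 p z≤n ⟩
        fromℕ (rank p ℕ.+ 2 ℕ.* toℕ p)
          ≤⟨ fromℕ-mono (ℕ.+-monoʳ-≤ (rank p) (ℕ.*-monoʳ-≤ 2 (ℕ.n≤1+n (toℕ p)))) ⟩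
        fromℕ (3 ℕ.* rank p) ∎
        where
        open ≤-Reasoning
        sel? = λ k → selected? k ×-dec (positionIn σ st (elementOf σ k) Fin.≤? p)

    -- A prefix event is paid by the request counters it deletes, an element
    -- event by the element counter it resets.
    response-paid : ∀ ev s → NonNegative σ s → Occurs σ ev s →
      fromℕ (actionsCost (response σ ev s)) + (fromℕ 2 * sum (requestCounter (handle σ ev s))
                                               + fromℕ 3 * sum (elementCounter (handle σ ev s))) ≤
      fromℕ 2 * sum (requestCounter s) + fromℕ 3 * sum (elementCounter s)
    response-paid (prefixEvent p) s valid (reached , _) = begin
      fromℕ (rank (double p) ℕ.+ 0) + (fromℕ 2 * R′ + fromℕ 3 * E)
        ≤⟨ +-mono-≤ (fromℕ-mono (ℕ.≤-trans (ℕ.≤-reflexive (ℕ.+-identityʳ _)) (rank-double-≤ p))) ≤-refl ⟩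
      fromℕ (2 ℕ.* rank p) + (fromℕ 2 * R′ + fromℕ 3 * E)
        ≈⟨ +-congʳ (trans (fromℕ-* 2 (rank p)) (*-congˡ (sym reached))) ⟩
      fromℕ 2 * deleted + (fromℕ 2 * R′ + fromℕ 3 * E)
        ≈⟨ solve 3 (λ d r e → con 2 :* d :+ (con 2 :* r :+ con 3 :* e) := con 2 :* (r :+ d) :+ con 3
            :* e) refl deleted R′ E ⟩
      fromℕ 2 * (R′ + deleted) + fromℕ 3 * E
        ≈⟨ +-congʳ (*-congˡ split) ⟨
      fromℕ 2 * R + fromℕ 3 * E ∎
      where
      open ≤-Reasoning
      R = sum (requestCounter s)
      R′ = sum (requestCounter (handle σ (prefixEvent p) s))
      E = sum (elementCounter s)
      within = λ k → does (positionIn σ s (elementOf σ k) Fin.≤? p)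
      deleted = sum (λ k → requestCounter s k when within k)
      splitAt : ∀ {x} b → x ≈ (if b then 0# else x) + x when b
      splitAt true  = sym (+-identityˡ _)
      splitAt false = sym (+-identityʳ _)
      split : R ≈ R′ + deleted
      split = trans (sum-cong-≋ {m} (λ k → splitAt (within k)))
        (∑-distrib-+ (requestCounter (handle σ (prefixEvent p) s)) (λ k → requestCounter s k when within k))
    response-paid ev@(elementEvent e) s valid (reached , _) = begin
      fromℕ (actionsCost (response σ ev s)) + (fromℕ 2 * R′ + fromℕ 3 * E′)
        ≤⟨ +-mono-≤ (fromℕ-mono cost≤) (+-mono-≤ (scale-mono 2 (sum-mono {m} R′≤R)) ≤-refl) ⟩
      fromℕ (3 ℕ.* rank p) + (fromℕ 2 * R + fromℕ 3 * E′)
        ≈⟨ +-congʳ (trans (fromℕ-* 3 (rank p)) (*-congˡ (sym reached))) ⟩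
      fromℕ 3 * elementCounter s e + (fromℕ 2 * R + fromℕ 3 * E′)
        ≈⟨ solve 3 (λ d r e → con 3 :* d :+ (con 2 :* r :+ con 3 :* e) := con 2 :* r :+ con 3 :*
            (e :+ d)) refl (elementCounter s e) R E′ ⟩
      fromℕ 2 * R + fromℕ 3 * (E′ + elementCounter s e)
        ≈⟨ +-congˡ (*-congˡ (reset-elementCounters σ e s)) ⟨
      fromℕ 2 * R + fromℕ 3 * E ∎
      where
      open ≤-Reasoning
      p = positionIn σ s e
      R = sum (requestCounter s)
      R′ = sum (requestCounter (handle σ ev s))
      E = sum (elementCounter s)
      E′ = sum (elementCounter (handle σ ev s))
      cost≤ : actionsCost (response σ ev s) ℕ.≤ 3 ℕ.* rank p
      cost≤ = ℕ.≤-trans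
        (ℕ.+-mono-≤ (rank-double-≤ p) (ℕ.≤-trans (ℕ.≤-reflexive (moveToFront-cost p)) (ℕ.n≤1+n (toℕ p))))
        (ℕ.≤-reflexive (ℕ.+-comm (2 ℕ.* rank p) (rank p)))
      erase-≤ : ∀ {x} b → 0# ≤ x → (if b then 0# else x) ≤ x
      erase-≤ true  0≤x = 0≤x
      erase-≤ false 0≤x = ≤-refl
      R′≤R : ∀ k → requestCounter (handle σ ev s) k ≤ requestCounter s k
      R′≤R k = erase-≤ (deletes σ ev s k) (requests valid k)

    -- The weights 2 and 3 are the prices per unit of rank of a doubled access, without and with a
    -- move to the front. Future delay has yet to enter both kinds of counters and therefore weighs
    -- 5.
    actions-≤ : ∀ {st} (r : Run σ st) → NonNegative σ st → Bounded σ T (schedule σ r) → time st ≤ T →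
      fromℕ (scheduleCost (schedule σ r)) ≤
      fromℕ 5 * sum (fut σ T r (time st)) + (fromℕ 2 * sum (requestCounter st) + fromℕ 3 * sum
          (elementCounter st))
    actions-≤ {st} r@(stop quiet) valid bnd st≤T = +-nonNeg
      (*-nonNegative (0≤fromℕ 5) (sum-nonNeg {m} (fut-nonNeg σ T r (time st) bnd st≤T (Until-start σ r))))
      (+-nonNeg (*-nonNegative (0≤fromℕ 2) (sum-nonNeg (requests valid)))
                (*-nonNegative (0≤fromℕ 3) (sum-nonNeg (elements valid))))
    actions-≤ {st} r@(event t ev t≥ quiet occ r′) valid bnd st≤T = begin
      fromℕ (scheduleCost (timedResponse σ ev s ++ schedule σ r′))
        ≈⟨ trans (reflexive (≡.cong fromℕ (≡.trans (scheduleCost-++ (timedResponse σ ev s) (schedule σ r′))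
             (≡.cong (ℕ._+ scheduleCost (schedule σ r′)) (scheduleCost-timed t (response σ ev s))))))
             (fromℕ-+ (actionsCost (response σ ev s)) (scheduleCost (schedule σ r′))) ⟩
      A + fromℕ (scheduleCost (schedule σ r′))
        ≤⟨ +-monoʳ-≤ A (actions-≤ r′ (handle-nonNegative σ ev valid′) bnd′ t≤T) ⟩
      A + (fromℕ 5 * sum (fut σ T r′ t) + (fromℕ 2 * sum (requestCounter s′) + fromℕ 3 * sum
          (elementCounter s′)))
        ≈⟨ solve 3 (λ a f p → a :+ (f :+ p) := f :+ (a :+ p)) refl A (fromℕ 5 * sum (fut σ T r′ t)) _ ⟩
      fromℕ 5 * sum (fut σ T r′ t) + (A + (fromℕ 2 * sum (requestCounter s′) + fromℕ 3 * sum
          (elementCounter s′)))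
        ≤⟨ +-monoʳ-≤ _ (response-paid ev s valid′ occ) ⟩
      fromℕ 5 * sum (fut σ T r′ t) + (fromℕ 2 * sum (requestCounter s) + fromℕ 3 * sum (elementCounter s))
        ≈⟨ +-congˡ (+-cong (*-congˡ (wait-requestCounters σ t st))
            (*-congˡ (wait-elementCounters σ t st))) ⟩
      fromℕ 5 * sum (fut σ T r′ t) + (fromℕ 2 * (R + D) + fromℕ 3 * (E + D))
        ≈⟨ solve 4 (λ f r e d → con 5 :* f :+ (con 2 :* (r :+ d) :+ con 3 :* (e :+ d)) :=
                                con 5 :* (d :+ f) :+ (con 2 :* r :+ con 3 :* e)) refl
                                    (sum (fut σ T r′ t)) R E D ⟩
      fromℕ 5 * (D + sum (fut σ T r′ t)) + (fromℕ 2 * R + fromℕ 3 * E)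
        ≈⟨ +-congʳ (*-congˡ (trans (sum-cong-≋ {m} unfold) (∑-distrib-+ (delayIncurred σ t st)
            (fut σ T r′ t)))) ⟨
      fromℕ 5 * sum (fut σ T r (time st)) + (fromℕ 2 * R + fromℕ 3 * E) ∎
      where
      open ≤-Reasoning
      s = wait σ t st
      s′ = handle σ ev s
      valid′ = wait-nonNegative σ valid t≥
      bnd′ = All.++⁻ʳ (timedResponse σ ev s) bnd
      t≤T = event-≤T σ T ev s (All.++⁻ˡ _ bnd)
      A = fromℕ (actionsCost (response σ ev s))
      R = sum (requestCounter st)
      E = sum (elementCounter st)
      D = sum (delayIncurred σ t st)
      unfold : ∀ k → fut σ T r (time st) k ≈ delayIncurred σ t st k + fut σ T r′ t k
      unfold k = trans (due-wait σ T (configuration st) (schedule σ r) (time st) t k)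
        (+-cong (reflexive (≡.sym (delayIncurred≡incurred σ t st k))) (fut-event σ T t ev t≥ quiet
            occ r′ k))

-- The potential, and its change as time passes.

module Amortization {c ℓ₁ ℓ₂} (ℝ : RealNumbers c ℓ₁ ℓ₂) where

  open Reals ℝ
  open ListUpdate ℝ
  open Request
  open Inversions
    using (pos; indicator; inversions; inversions-swap; pos-swap-≤; count-pos≡)
  open Potential ℝ
  open Dynamics ℝ
  open Online ℝ
  open Accounts ℝ

  when-cong : ∀ {x y} b → x ≈ y → x when b ≈ y when b
  when-cong true  x≈y = x≈y
  when-cong false x≈y = refl

  module _ {n m} (σ : Input n m) (T : Carrier) where

    Served : Configuration σ → Fin m → Set c
    Served C k = ∃[ s ] served C k ≡ just s

    served? : ∀ C k → Dec (Served C k)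
    served? C k with served C k
    ... | just s  = yes (s , ≡.refl)
    ... | nothing = no λ ()

    unserved : ∀ C k → ¬ Served C k → served C k ≡ nothing
    unserved C k ¬served with served C k
    ... | just s  = contradiction (s , ≡.refl) ¬served
    ... | nothing = ≡.refl

    servedFor? : ∀ C e k → Dec (Served C k × elementOf σ k ≡ e)
    servedFor? C e k = served? C k ×-dec (elementOf σ k Fin.≟ e)

    -- OPT acts between events of ALG, so counters are needed at times after the last recorded
    -- state.
    counterAt : State σ → Carrier → Fin n → Carrier
    counterAt st τ = elementCounter (wait σ τ st)

    module _ {st} (r : Run σ st) (τ : Carrier) (C : Configuration σ) where

      -- This is the quantity F of the potential.
      exposure : Fin n → Carrier
      exposure e = sum (λ k → fut σ T r τ k when does (servedFor? C e k))

      Φ : Fin n → Carrier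
      Φ e = ψ (inversions (order (configuration st)) (order C) e)
              (rank (positionIn σ st e)) (rank (position (order C) e))
              (counterAt st τ e) (exposure e)

      -- A meeting point of the two solutions: `τ` lies between ALG's last handled event and its
      -- next one, and all that OPT has served has arrived by then.
      record Joint : Set (c ⊔ ℓ₁ ⊔ ℓ₂) where
        field
          started     : time st ≤ τ
          until       : Until σ r τ
          τ≤T         : τ ≤ T
          nonNegative : NonNegative σ st
          bounded     : Bounded σ T (schedule σ r)
          arrived     : ∀ k → Served C k → arrival (σ k) ≤ τ

    open Joint

    -- The sum of counters is the term - E moved across the inequality. Waiting only shifts delay
    -- from the first sum to the second.
    outstanding : ∀ {st} → Run σ st → Carrier → Carrier
    outstanding {st} r τ = sum (fut σ T r τ) + sum (counterAt st τ)

    counterAt-nonNeg : ∀ {st} (r : Run σ st) τ C → Joint r τ C → ∀ e → 0# ≤ counterAt st τ e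
    counterAt-nonNeg r τ C J = elements (wait-nonNegative σ (nonNegative J) (started J))

    exposure-nonNeg : ∀ {st} (r : Run σ st) τ C → Joint r τ C → ∀ e → 0# ≤ exposure r τ C e
    exposure-nonNeg r τ C J e = sum-nonNeg {m} (λ k → when-nonNeg (does (servedFor? C e k))
      (fut-nonNeg σ T r τ (bounded J) (τ≤T J) (until J) k))

    exposure-≤ : ∀ {st} (r : Run σ st) τ C → Joint r τ C → ∀ e →
                 exposure r τ C e ≤ fromℕ (rank (positionIn σ st e))
    exposure-≤ r τ C J e =
      fut-element-≤ σ T r τ (started J) (until J) (τ≤T J) (nonNegative J) (bounded J) (served? C)
          (arrived J) e

    counterAt-wait : ∀ st τ τ′ e → counterAt st τ′ e ≈
      counterAt st τ e + sum (λ k → incurred σ (configuration st) τ τ′ k when does (elementOf σ k Fin.≟ e))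
    counterAt-wait st τ τ′ e = trans (+-congˡ (trans (sum-cong-≋ {m} split)
      (∑-distrib-+ (λ k → delayIncurred σ τ st k when does (elementOf σ k Fin.≟ e))
                   (λ k → incurred σ (configuration st) τ τ′ k when does (elementOf σ k Fin.≟ e)))))
      (sym (+-assoc _ _ _))
      where
      split : ∀ k → delayIncurred σ τ′ st k when does (elementOf σ k Fin.≟ e) ≈
                    delayIncurred σ τ st k when does (elementOf σ k Fin.≟ e) +
                    incurred σ (configuration st) τ τ′ k when does (elementOf σ k Fin.≟ e)
      split k = trans (when-cong (does (elementOf σ k Fin.≟ e)) (begin-equality
        delayIncurred σ τ′ st k                               ≡⟨ delayIncurred≡incurred σ τ′ st k ⟩
        incurred σ (configuration st) (time st) τ′ k          ≈⟨ incurred-+ σ (configuration st)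
            (time st) τ τ′ k ⟨
        incurred σ (configuration st) (time st) τ k + incurred σ (configuration st) τ τ′ k
          ≡⟨ ≡.cong (_+ incurred σ (configuration st) τ τ′ k) (delayIncurred≡incurred σ τ st k) ⟨
        delayIncurred σ τ st k + incurred σ (configuration st) τ τ′ k ∎))
        (when-distrib-+ (delayIncurred σ τ st k) (incurred σ (configuration st) τ τ′ k)
            (does (elementOf σ k Fin.≟ e)))
        where open ≤-Reasoning

    outstanding-wait : ∀ {st} (r : Run σ st) τ τ′ → outstanding r τ ≈ outstanding r τ′
    outstanding-wait {st} r τ τ′ = begin-equality
      sum (fut σ T r τ) + sum (counterAt st τ)
        ≈⟨ +-congʳ (trans (sum-cong-≋ {m} (due-wait σ T (configuration st) (schedule σ r) τ τ′))
                          (∑-distrib-+ a (fut σ T r τ′))) ⟩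
      (sum a + sum (fut σ T r τ′)) + sum (counterAt st τ)
        ≈⟨ solve 3 (λ a f e → (a :+ f) :+ e := f :+ (e :+ a)) refl (sum a) (sum (fut σ T r τ′))
            (sum (counterAt st τ)) ⟩
      sum (fut σ T r τ′) + (sum (counterAt st τ) + sum a)
        ≈⟨ +-congˡ (trans (sum-cong-≋ {n} (counterAt-wait st τ τ′))
             (trans (∑-distrib-+ (counterAt st τ) (λ e → sum (λ k → a k when does (elementOf σ k Fin.≟ e))))
               (+-congˡ (sum-fibres (elementOf σ) a)))) ⟨
      sum (fut σ T r τ′) + sum (counterAt st τ′) ∎
      where
      open ≤-Reasoning
      a = incurred σ (configuration st) τ τ′

    Joint-wait : ∀ {st} (r : Run σ st) {τ} τ′ C → Joint r τ C → τ ≤ τ′ → Until σ r τ′ → τ′ ≤ T →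
        Joint r τ′ C
    Joint-wait r τ′ C J τ≤τ′ until′ τ′≤T = record
      { started     = ≤-trans (started J) τ≤τ′
      ; until       = until′
      ; τ≤T         = τ′≤T
      ; nonNegative = nonNegative J
      ; bounded     = bounded J
      ; arrived     = λ k sv → ≤-trans (arrived J k sv) τ≤τ′
      }

    Φ-wait : ∀ {st} (r : Run σ st) τ τ′ C → Joint r τ C → Joint r τ′ C → τ ≤ τ′ →
             sum (Φ r τ′ C) ≤ sum (Φ r τ C) + fromℕ 3 * sum (incurred σ C τ τ′)
    Φ-wait {st} r τ τ′ C J J′ τ≤τ′ = begin
      sum (Φ r τ′ C)
        ≤⟨ sum-mono {n} pointwise ⟩
      sum (λ e → Φ r τ C e + fromℕ 3 * O e)
        ≈⟨ ∑-distrib-+ (Φ r τ C) (λ e → fromℕ 3 * O e) ⟩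
      sum (Φ r τ C) + sum (λ e → fromℕ 3 * O e)
        ≈⟨ +-congˡ (trans (sum-scale (fromℕ 3) O) (*-congˡ (sum-fibres (elementOf σ) o))) ⟩
      sum (Φ r τ C) + fromℕ 3 * sum o ∎
      where
      open ≤-Reasoning
      o = incurred σ C τ τ′
      a = incurred σ (configuration st) τ τ′
      a-nonNeg = λ k → incurred-nonNeg σ (configuration st) k τ≤τ′
      O B : Fin n → Carrier
      O e = sum (λ k → o k when does (elementOf σ k Fin.≟ e))
      B e = sum (λ k → a k when does (servedFor? C e k))

      o-nonNeg : ∀ k b → 0# ≤ o k when b
      o-nonNeg k b = when-nonNeg b (incurred-nonNeg σ C k τ≤τ′)
      b-nonNeg : ∀ k b → 0# ≤ a k when b
      b-nonNeg k b = when-nonNeg b (a-nonNeg k)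

      a≤o : ∀ k → ¬ Served C k → a k ≤ o k
      a≤o k ¬served with served C k
      ... | just s  = contradiction (s , ≡.refl) ¬served
      ... | nothing with served (configuration st) k
      ...   | just _  = 0≤y-x (delay-mono (σ k) τ≤τ′)
      ...   | nothing = ≤-refl

      -- A request that OPT has served pays from the exposure. Any other is pending in OPT, which
      -- incurs at least as much on it over the same interval.
      charge : ∀ e k → a k when does (elementOf σ k Fin.≟ e) ≤
                       o k when does (elementOf σ k Fin.≟ e) + a k when does (servedFor? C e k)
      charge e k = when-≤-dec (elementOf σ k Fin.≟ e) (λ el≡e → go el≡e (served? C k))
        (+-nonNeg (o-nonNeg k _) (b-nonNeg k _))
        where
        go : elementOf σ k ≡ e → Dec (Served C k) →
             a k ≤ o k when does (elementOf σ k Fin.≟ e) + a k when does (servedFor? C e k)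
        go el≡e (yes sv) = ≤-trans (≤-when-dec (servedFor? C e k) (sv , el≡e) ≤-refl)
            (b≤a+b _ (o-nonNeg k _))
        go el≡e (no ¬sv) = ≤-trans (≤-when-dec (elementOf σ k Fin.≟ e) el≡e (a≤o k ¬sv))
            (a≤a+b _ (b-nonNeg k _))

      exposure-wait : ∀ e → exposure r τ C e ≈ exposure r τ′ C e + B e
      exposure-wait e = trans (sum-cong-≋ {m} (λ k → trans
          (when-cong (does (servedFor? C e k))
              (trans (due-wait σ T (configuration st) (schedule σ r) τ τ′ k) (+-comm _ _)))
          (when-distrib-+ (fut σ T r τ′ k) (a k) (does (servedFor? C e k)))))
        (∑-distrib-+ (λ k → fut σ T r τ′ k when does (servedFor? C e k))
            (λ k → a k when does (servedFor? C e k)))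

      pointwise : ∀ e → Φ r τ′ C e ≤ Φ r τ C e + fromℕ 3 * O e
      pointwise e = begin
        Φ r τ′ C e
          ≤⟨ ψ-monoʳ I x y (≤-respˡ-≈ (sym (counterAt-wait st τ τ′ e))
               (+-monoʳ-≤ (counterAt st τ e) (≤-trans (sum-mono {m} (charge e))
                 (≤-reflexive (∑-distrib-+ (λ k → o k when does (elementOf σ k Fin.≟ e))
                     (λ k → a k when does (servedFor? C e k))))))) ≤-refl ⟩
        ψ I x y (counterAt st τ e + (O e + B e)) (exposure r τ′ C e)
          ≤⟨ ψ-wait I x y (counterAt-nonNeg r τ C J e) (sum-nonNeg {m} (λ k → o-nonNeg k _))
               (sum-nonNeg {m} (λ k → b-nonNeg k _)) (≤-respˡ-≈ (exposure-wait e) (exposure-≤ r τ C J e)) ⟩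
        ψ I x y (counterAt st τ e) (exposure r τ′ C e + B e) + fromℕ 3 * O e
          ≤⟨ +-mono-≤ (ψ-monoʳ I x y ≤-refl (≤-reflexive (sym (exposure-wait e)))) ≤-refl ⟩
        Φ r τ C e + fromℕ 3 * O e ∎
        where
        I = inversions (order (configuration st)) (order C) e
        x = rank (positionIn σ st e)
        y = rank (position (order C) e)

  -- The change of the potential under actions of OPT.

  -- One element falls back in OPT's list, at price 40, and one comes forward and may gain an
  -- inversion, at price 2.
  Φ-swap : ∀ {n m} (σ : Input (suc n) m) T {st} (r : Run σ st) τ C i →
           sum (Φ σ T r τ (perform σ C (τ , swap i))) ≤ sum (Φ σ T r τ C) + fromℕ 54 * fromℕ 1
  Φ-swap {n} σ T {st} r τ C i = begin
    sum (Φ σ T r τ C′)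
      ≤⟨ sum-mono {suc n} (λ e → ψ-swap
           (inversions π ρ e) (inversions π (order C′) e) (rank (positionIn σ st e))
           (rank (position ρ e)) (rank (position (order C′) e)) (raised e) (lowered e)
           (counterAt σ T st τ e) (exposure σ T r τ C e)
           (inversions-swap ρ i π e) (s≤s (pos-swap-≤ ρ i e))) ⟩
    sum (λ e → Φ σ T r τ C e + (fromℕ 2 * fromℕ (raised e) + fromℕ 40 * fromℕ (lowered e)))
      ≈⟨ trans (∑-distrib-+ (Φ σ T r τ C) (λ e → fromℕ 2 * fromℕ (raised e) + fromℕ 40 * fromℕ (lowered e)))
           (+-congˡ (trans (∑-distrib-+ (λ e → fromℕ 2 * fromℕ (raised e))
               (λ e → fromℕ 40 * fromℕ (lowered e)))
             (+-cong (counted 2 raised) (counted 40 lowered)))) ⟩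
    sum (Φ σ T r τ C) + (fromℕ 2 * fromℕ (ℕsum raised) + fromℕ 40 * fromℕ (ℕsum lowered))
      ≤⟨ +-monoʳ-≤ _ (+-mono-≤ (scale-mono 2 (fromℕ-mono (count-pos≡ ρ (s≤s (Fin.toℕ<n i)))))
                               (scale-mono 40 (fromℕ-mono (count-pos≡ ρ (ℕ.m<n⇒m<1+n (Fin.toℕ<n i)))))) ⟩
    sum (Φ σ T r τ C) + (fromℕ 2 * fromℕ 1 + fromℕ 40 * fromℕ 1)
      -- The price 42 is rounded up to 54, the rate of accesses, so that one rate fits all actions.
      ≤⟨ +-monoʳ-≤ _ (≤-linear (0≤fromℕ 12)
           (solve 0 (con 2 :* con 1 :+ con 40 :* con 1 :+ con 12 := con 54 :* con 1 :+ con 0) refl)) ⟩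
    sum (Φ σ T r τ C) + fromℕ 54 * fromℕ 1 ∎
    where
    open ≤-Reasoning
    C′ = perform σ C (τ , swap i)
    π = order (configuration st)
    ρ = order C
    ℕsum : Vector ℕ (suc n) → ℕ
    ℕsum = Sum.sum ℕ.+-0-commutativeMonoid
    raised lowered : Fin (suc n) → ℕ
    raised e  = indicator (pos ρ e ℕ.≟ suc (toℕ i))
    lowered e = indicator (pos ρ e ℕ.≟ toℕ i)
    counted : ∀ k f → sum (λ e → fromℕ k * fromℕ (f e)) ≈ fromℕ k * fromℕ (ℕsum f)
    counted k f = trans (sum-scale (fromℕ k) (fromℕ ∘ f)) (*-congˡ (sym (sum-fromℕ f)))

  -- The last position of rank at most `6 * rank p`, cut off at the end of the list. Counted from
  -- zero its index is `5 + 6 * toℕ p`.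
  reach : ∀ {n} → Fin n → Fin n
  reach {suc n} p = fromℕ< (s≤s (ℕ.m⊓n≤n (5 ℕ.+ 6 ℕ.* toℕ p) n))

  rank-reach-≤ : ∀ {n} (p : Fin n) → rank (reach p) ℕ.≤ 6 ℕ.* rank p
  rank-reach-≤ {suc n} p = ℕ.≤-trans
    (s≤s (ℕ.≤-trans (ℕ.≤-reflexive (Fin.toℕ-fromℕ< _)) (ℕ.m⊓n≤m (5 ℕ.+ 6 ℕ.* toℕ p) n)))
    (ℕ.≤-reflexive (≡.sym (ℕ.*-suc 6 (toℕ p))))

  ≤-reach : ∀ {n} (q p : Fin n) → toℕ q ℕ.< 6 ℕ.* rank p → q Fin.≤ reach p
  ≤-reach {suc n} q p q<6p = ℕ.≤-trans
    (ℕ.⊓-glb (ℕ.s≤s⁻¹ (ℕ.≤-trans q<6p (ℕ.≤-reflexive (ℕ.*-suc 6 (toℕ p))))) (ℕ.s≤s⁻¹ (Fin.toℕ<n q)))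
    (ℕ.≤-reflexive (≡.sym (Fin.toℕ-fromℕ< _)))

  module _ {n m} (σ : Input n m) (T : Carrier) where

    open Joint

    Joint-perform : ∀ {st} (r : Run σ st) τ C a → Joint σ T r τ C → Joint σ T r τ (perform σ C (τ , a))
    Joint-perform r τ C a J = record
      { started     = started J
      ; until       = until J
      ; τ≤T         = τ≤T J
      ; nonNegative = nonNegative J
      ; bounded     = bounded J
      ; arrived     = arr a
      }
      where
      arr : ∀ a k → Served σ T (perform σ C (τ , a)) k → arrival (σ k) ≤ τ
      arr (swap _)   k sv = arrived J k sv
      arr (access p) k (_ , eq) with served? σ T C k
      ... | yes sv = arrived J k sv
      ... | no ¬sv = proj₁ (serve-access⁻¹ σ τ p C k (unserved σ T C k ¬sv) eq)

    -- The rate is 54 = 3 · 3 · 6: the weight of the exposure, the constant of the prefix bound, and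
    -- the ratio of ranks up to which an element is near.
    Φ-access : ∀ {st} (r : Run σ st) τ C p → Joint σ T r τ C →
               sum (Φ σ T r τ (perform σ C (τ , access p))) ≤ sum (Φ σ T r τ C) + fromℕ 54 * fromℕ (rank p)
    Φ-access {st} r τ C p J = begin
      sum (Φ σ T r τ C′)
        ≤⟨ sum-mono {n} pointwise ⟩
      sum (λ e → Φ σ T r τ C e + fromℕ 3 * (g e when does (near? e)))
        ≈⟨ trans (∑-distrib-+ (Φ σ T r τ C) (λ e → fromℕ 3 * (g e when does (near? e))))
             (+-congˡ (sum-scale (fromℕ 3) (λ e → g e when does (near? e)))) ⟩
      sum (Φ σ T r τ C) + fromℕ 3 * sum (λ e → g e when does (near? e))
        ≤⟨ +-monoʳ-≤ _ (scale-mono 3 (≤-trans (sum-mono {n} near-≤)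
            (≤-reflexive (sum-fibres (elementOf σ) h)))) ⟩
      sum (Φ σ T r τ C) + fromℕ 3 * sum h
        ≤⟨ +-monoʳ-≤ _ (scale-mono 3 (≤-trans
             (fut-prefix-≤ σ T r τ (started J) (until J) (τ≤T J) (nonNegative J) (bounded J) new?
               (λ k (_ , sv) → arrived J′ k sv) (reach p))
             (fromℕ-mono (ℕ.*-monoʳ-≤ 3 (rank-reach-≤ p))))) ⟩
      sum (Φ σ T r τ C) + fromℕ 3 * fromℕ (3 ℕ.* (6 ℕ.* rank p))
        ≈⟨ +-congˡ (trans (*-congˡ (trans (fromℕ-* 3 (6 ℕ.* rank p)) (*-congˡ (fromℕ-* 6 (rank p)))))
             (solve 1 (λ b → con 3 :* (con 3 :* (con 6 :* b)) := con 54 :* b) refl (fromℕ (rank p)))) ⟩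
      sum (Φ σ T r τ C) + fromℕ 54 * fromℕ (rank p) ∎
      where
      open ≤-Reasoning
      C′ = perform σ C (τ , access p)
      J′ = Joint-perform r τ C (access p) J
      f = fut σ T r τ
      f-nonNeg : ∀ k b → 0# ≤ f k when b
      f-nonNeg k b = when-nonNeg b (fut-nonNeg σ T r τ (bounded J) (τ≤T J) (until J) k)

      x y : Fin n → ℕ
      x e = rank (positionIn σ st e)
      y e = rank (position (order C) e)

      near? : ∀ e → Dec (x e ℕ.< 6 ℕ.* y e)
      near? e = x e ℕ.<? 6 ℕ.* y e

      new? : ∀ k → Dec (¬ Served σ T C k × Served σ T C′ k)
      new? k = ¬? (served? σ T C k) ×-dec served? σ T C′ k

      newFor? : ∀ e k → Dec ((¬ Served σ T C k × Served σ T C′ k) × elementOf σ k ≡ e)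
      newFor? e k = new? k ×-dec (elementOf σ k Fin.≟ e)

      newWithin? : ∀ k → Dec ((¬ Served σ T C k × Served σ T C′ k) × positionIn σ st (elementOf σ k)
          Fin.≤ reach p)
      newWithin? k = new? k ×-dec (positionIn σ st (elementOf σ k) Fin.≤? reach p)

      g : Fin n → Carrier
      g e = sum (λ k → f k when does (newFor? e k))

      h : Fin m → Carrier
      h k = f k when does (newWithin? k)

      split : ∀ e k → f k when does (servedFor? σ T C′ e k) ≤
                      f k when does (servedFor? σ T C e k) + f k when does (newFor? e k)
      split e k = when-≤-dec (servedFor? σ T C′ e k) (λ (sv′ , el≡e) → go sv′ el≡e (served? σ T C k))
        (+-nonNeg (f-nonNeg k _) (f-nonNeg k _))
        where
        go : Served σ T C′ k → elementOf σ k ≡ e → Dec (Served σ T C k) →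
             f k ≤ f k when does (servedFor? σ T C e k) + f k when does (newFor? e k)
        go sv′ el≡e (yes sv) = ≤-trans (≤-when-dec (servedFor? σ T C e k) (sv , el≡e) ≤-refl)
            (a≤a+b _ (f-nonNeg k _))
        go sv′ el≡e (no ¬sv) = ≤-trans (≤-when-dec (newFor? e k) ((¬sv , sv′) , el≡e) ≤-refl)
            (b≤a+b _ (f-nonNeg k _))

      pointwise : ∀ e → Φ σ T r τ C′ e ≤ Φ σ T r τ C e + fromℕ 3 * (g e when does (near? e))
      pointwise e = ≤-trans
        (ψ-monoʳ (inversions (order (configuration st)) (order C) e) (x e) (y e) ≤-refl
          (≤-trans (sum-mono {m} (split e)) (≤-reflexive
            (∑-distrib-+ (λ k → f k when does (servedFor? σ T C e k))
                (λ k → f k when does (newFor? e k))))))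
        (ψ-access (inversions (order (configuration st)) (order C) e) (x e) (y e)
            (counterAt σ T st τ e) (near? e)
          (exposure-nonNeg σ T r τ C J e) (sum-nonNeg {m} (λ k → f-nonNeg k _)))

      near-≤ : ∀ e → g e when does (near? e) ≤ sum (λ k → h k when does (elementOf σ k Fin.≟ e))
      near-≤ e = when-≤-dec (near? e) (λ near → sum-mono {m} (λ k → when-≤-dec (newFor? e k)
          (λ { ((¬sv , sv′) , ≡.refl) → ≤-when-dec (elementOf σ k Fin.≟ e) ≡.refl
                 (≤-when-dec (newWithin? k) ((¬sv , sv′) , within k ¬sv sv′ near) ≤-refl) })
          (h-nonNeg k (does (elementOf σ k Fin.≟ e)))))
        (sum-nonNeg {m} (λ k → h-nonNeg k (does (elementOf σ k Fin.≟ e))))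
        where
        h-nonNeg : ∀ k b → 0# ≤ h k when b
        h-nonNeg k b = when-nonNeg b (f-nonNeg k _)
        within : ∀ k → ¬ Served σ T C k → Served σ T C′ k → x (elementOf σ k) ℕ.< 6 ℕ.* y (elementOf σ k) →
                 positionIn σ st (elementOf σ k) Fin.≤ reach p
        -- A newly served request has rank at most `rank p` in OPT's list, so nearness puts its rank
        -- in ALG's list below `6 * rank p`.
        within k ¬sv (_ , eq) near = ≤-reach (positionIn σ st (elementOf σ k)) p
          (ℕ.<-≤-trans (ℕ.<-trans (ℕ.n<1+n _) near)
            (ℕ.*-monoʳ-≤ 6 (s≤s (proj₂ (serve-access⁻¹ σ τ p C k (unserved σ T C k ¬sv) eq)))))

    Φ-perform : ∀ {st} (r : Run σ st) τ C a → Joint σ T r τ C →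
                sum (Φ σ T r τ (perform σ C (τ , a))) ≤ sum (Φ σ T r τ C) + fromℕ 54 * fromℕ (actionCost a)
    Φ-perform r τ C (access p) J = Φ-access r τ C p J
    Φ-perform r τ C (swap i)   J = Φ-swap σ T r τ C i

-- The change of the potential under events of ALG.

module Competitive {c ℓ₁ ℓ₂} (ℝ : RealNumbers c ℓ₁ ℓ₂) where

  open Reals ℝ
  open ListUpdate ℝ
  open Request
  open Inversions
    using (indicator; inversions; inversions-refl; agreement?; agreements; inversions-moved;
           inversions-moved-self; pos-moved≥; rank≤inversions+rank; inversions+agreements≤pos)
  open Potential ℝ
  open Dynamics ℝ
  open Online ℝ
  open Accounts ℝ
  open Amortization ℝ

  module _ {n m} (σ : Input n m) (T : Carrier) where

    open Joint

    counterAt-now : ∀ st e → counterAt σ T st (time st) e ≈ elementCounter st e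
    counterAt-now st e = trans (+-congˡ (sum-zero {m} (λ k →
      when-zero-dec (elementOf σ k Fin.≟ e) (λ _ → trans
        (reflexive (delayIncurred≡incurred σ (time st) st k))
        (incurred-refl σ (configuration st) (time st) k))))) (+-identityʳ _)

    module _ {st} t ev t≥ quiet (occ : Occurs σ ev (wait σ t st)) (r′ : Run σ (handle σ ev (wait σ t st)))
             C (J : Joint σ T {st} (event t ev t≥ quiet occ r′) t C) where

      private
        s s′ : State σ
        s  = wait σ t st
        s′ = handle σ ev s
        r : Run σ st
        r = event t ev t≥ quiet occ r′
        ρ = order C

      Joint-event : Joint σ T r′ t C
      Joint-event = record
        { started     = ≤-refl
        ; until       = Until-start σ r′
        ; τ≤T         = τ≤T J
        ; nonNegative = handle-nonNegative σ ev (wait-nonNegative σ (nonNegative J) t≥)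
        ; bounded     = All.++⁻ʳ (timedResponse σ ev s) (bounded J)
        ; arrived     = arrived J
        }

      exposure-event : ∀ e → exposure σ T r t C e ≈ exposure σ T r′ t C e
      exposure-event e = sum-cong-≋ {m} (λ k →
        when-cong (does (servedFor? σ T C e k)) (fut-event σ T t ev t≥ quiet occ r′ k))

    module _ {st} t p t≥ quiet (occ : Occurs σ (prefixEvent p) (wait σ t st)) r′
             C (J : Joint σ T {st} (event t (prefixEvent p) t≥ quiet occ r′) t C) where

      private
        s = wait σ t st
        s′ = handle σ (prefixEvent p) s
        r = event {σ = σ} {st = st} t (prefixEvent p) t≥ quiet occ r′

      outstanding-prefixEvent : outstanding σ T r t ≈ outstanding σ T r′ t
      outstanding-prefixEvent = +-cong
        (sum-cong-≋ {m} (fut-event σ T t (prefixEvent p) t≥ quiet occ r′))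
        (sum-cong-≋ {n} (λ e → sym (counterAt-now s′ e)))

      -- An access changes neither the list nor the element counters, and request counters do not
      -- occur in the potential.
      Φ-prefixEvent : sum (Φ σ T r′ t C) ≤ sum (Φ σ T r t C)
      Φ-prefixEvent = sum-mono {n} (λ e → ψ-monoʳ
        (inversions (order (configuration st)) (order C) e) (rank (positionIn σ st e))
            (rank (position (order C) e))
        (≤-reflexive (counterAt-now s′ e))
        (≤-reflexive (sym (exposure-event t (prefixEvent p) t≥ quiet occ r′ C J e))))

    module _ {st} t e t≥ quiet (occ : Occurs σ (elementEvent e) (wait σ t st)) r′
             C (J : Joint σ T {st} (event t (elementEvent e) t≥ quiet occ r′) t C) where

      private
        s s′ : State σ
        s  = wait σ t st
        s′ = handle σ (elementEvent e) s
        r : Run σ st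
        r = event t (elementEvent e) t≥ quiet occ r′
        ρ = order C
        π = order (configuration s)
        π′ = order (configuration s′)
        x = rank (positionIn σ s e)

      outstanding-elementEvent : outstanding σ T r t ≈ outstanding σ T r′ t + fromℕ x
      outstanding-elementEvent = trans (+-cong
        (sum-cong-≋ {m} (fut-event σ T t (elementEvent e) t≥ quiet occ r′))
        (trans (reset-elementCounters σ e s)
            (+-cong (sum-cong-≋ {n} (λ f → sym (counterAt-now s′ f))) (proj₁ occ))))
        (sym (+-assoc _ _ _))

      private
        exposure-moved : exposure σ T r′ t C e ≈ 0#
        exposure-moved = sum-zero {m} (λ k → when-zero-dec (servedFor? σ T C e k) (λ { (sv , ≡.refl) →
          reflexive (due-served σ T (configuration s′) (schedule σ r′) t k
            (proj₂ (served-handle σ s (elementEvent e) k (arrived J k sv)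
                (≤-double (positionIn σ s e))))) }))

        counter-moved : counterAt σ T s′ t e ≈ 0#
        counter-moved = trans (counterAt-now s′ e)
          (reflexive (≡.cong (λ b → if b then 0# else elementCounter s e) (dec-true (e Fin.≟ e) ≡.refl)))

        -- Now `e` is first and its counter is zero. Its requests served by OPT had arrived, so
        -- ALG's access has left none of them pending.
        Φ-moved : Φ σ T r′ t C e ≤ 0#
        Φ-moved = ≤-trans
          (≤-trans (≤-reflexive (reflexive
              (≡.cong (λ I → ψ I x′ y (counterAt σ T s′ t e) (exposure σ T r′ t C e))
              (inversions-moved-self π π′ e (pos-element σ s e) ρ))))
            (ψ-monoʳ 0 x′ y (≤-reflexive counter-moved) (≤-reflexive exposure-moved)))
          (ψ-zero x′ y)
          where
          x′ = rank (positionIn σ s′ e)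
          y = rank (position ρ e)

        passed : Fin n → ℕ
        passed f = indicator (agreement? π ρ e f)

        counter-kept : ∀ f → f ≢ e → counterAt σ T s′ t f ≈ elementCounter s f
        counter-kept f f≢e = trans (counterAt-now s′ f)
          (reflexive (≡.cong (λ b → if b then 0# else elementCounter s f) (dec-false (f Fin.≟ e) f≢e)))

        -- Elements that are overtaken move back, which only lowers the caps; what can increase is
        -- the inversion count, through `e`.
        Φ-kept : ∀ f → f ≢ e → Φ σ T r′ t C f ≤ Φ σ T r t C f + fromℕ 2 * fromℕ (passed f)
        Φ-kept f f≢e = begin
          Φ σ T r′ t C f
            ≤⟨ ψ-mono {inversions π′ ρ f} {inversions π′ ρ f} {rank (positionIn σ s′ f)} {x′} {y} {y}
                 ℕ.≤-refl (s≤s (pos-moved≥ π π′ e (pos-element σ s e) f f≢e)) ℕ.≤-refl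
                 (≤-reflexive (counter-kept f f≢e))
                 (≤-reflexive (sym (exposure-event t (elementEvent e) t≥ quiet occ r′ C J f))) ⟩
          ψ (inversions π′ ρ f) x′ y (elementCounter s f) (exposure σ T r t C f)
            ≤⟨ ψ-swap (inversions π ρ f) (inversions π′ ρ f) x′ y y (passed f) 0
                (elementCounter s f) (exposure σ T r t C f)
                 (inversions-moved π π′ e (pos-element σ s e) ρ f f≢e)
                     (ℕ.≤-reflexive (≡.sym (ℕ.+-identityʳ y))) ⟩
          Φ σ T r t C f + (fromℕ 2 * fromℕ (passed f) + fromℕ 40 * fromℕ 0)
            ≈⟨ +-congˡ (trans (+-congˡ (zeroʳ (fromℕ 40))) (+-identityʳ _)) ⟩
          Φ σ T r t C f + fromℕ 2 * fromℕ (passed f) ∎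
          where
          open ≤-Reasoning
          x′ = rank (positionIn σ s f)
          y = rank (position ρ f)

        0≤2passed : ∀ f → 0# ≤ fromℕ 2 * fromℕ (passed f)
        0≤2passed f = *-nonNegative (0≤fromℕ 2) (0≤fromℕ (passed f))

        pointwise : ∀ f → Φ σ T r′ t C f + Φ σ T r t C f when does (e Fin.≟ f) ≤
                          Φ σ T r t C f + fromℕ 2 * fromℕ (passed f)
        pointwise f = go (e Fin.≟ f)
          where
          go : (d : Dec (e ≡ f)) → Φ σ T r′ t C f + Φ σ T r t C f when does d ≤
                                   Φ σ T r t C f + fromℕ 2 * fromℕ (passed f)
          go (yes ≡.refl) = ≤-trans (+-mono-≤ Φ-moved (a≤a+b (Φ σ T r t C e) (0≤2passed e)))
              (≤-reflexive (+-identityˡ _))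
          go (no e≢f)     = ≤-respˡ-≈ (sym (+-identityʳ _)) (Φ-kept f (e≢f ∘ ≡.sym))

        Φ-released : fromℕ 2 * fromℕ (agreements π ρ e) + fromℕ x ≤ Φ σ T r t C e
        Φ-released = begin
          fromℕ 2 * fromℕ A + fromℕ x  ≈⟨ trans (fromℕ-+ (2 ℕ.* A) x) (+-congʳ (fromℕ-* 2 A)) ⟨
          fromℕ (2 ℕ.* A ℕ.+ x)        ≤⟨ ψ-event I A x y x≤I+y
              (ℕ.m≤n⇒m≤1+n (inversions+agreements≤pos π ρ e))
                                            (exposure-nonNeg σ T r t C J e) ⟩
          ψ I x y (fromℕ x) (exposure σ T r t C e)
            ≤⟨ ψ-monoʳ I x y (≤-reflexive (sym (proj₁ occ))) ≤-refl ⟩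
          Φ σ T r t C e ∎
          where
          open ≤-Reasoning
          A = agreements π ρ e
          I = inversions π ρ e
          y = rank (position ρ e)
          x≤I+y : x ℕ.≤ I ℕ.+ y
          x≤I+y = rank≤inversions+rank π ρ e

      -- The summand of `e` is released entirely. After paying for the inversions created elsewhere
      -- it leaves `x`, the amount by which `outstanding` drops.
      Φ-elementEvent : sum (Φ σ T r′ t C) + fromℕ x ≤ sum (Φ σ T r t C)
      Φ-elementEvent = ≤-linear (+-mono-≤ before-after Φ-released)
        (solve 5 (λ a b c d x → (b :+ x) :+ ((a :+ d) :+ c) := a :+ ((b :+ c) :+ (d :+ x))) refl
          (sum (Φ σ T r t C)) (sum (Φ σ T r′ t C)) (Φ σ T r t C e)
              (fromℕ 2 * fromℕ (agreements π ρ e)) (fromℕ x))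
        where
        open ≤-Reasoning
        before-after : sum (Φ σ T r′ t C) + Φ σ T r t C e ≤
                       sum (Φ σ T r t C) + fromℕ 2 * fromℕ (agreements π ρ e)
        before-after = begin
          sum (Φ σ T r′ t C) + Φ σ T r t C e
            ≈⟨ trans (∑-distrib-+ (Φ σ T r′ t C) (λ f → Φ σ T r t C f when does (e Fin.≟ f)))
                 (+-congˡ (sum-single (Φ σ T r t C) e)) ⟨
          sum (λ f → Φ σ T r′ t C f + Φ σ T r t C f when does (e Fin.≟ f))
            ≤⟨ sum-mono {n} pointwise ⟩
          sum (λ f → Φ σ T r t C f + fromℕ 2 * fromℕ (passed f))
            ≈⟨ trans (∑-distrib-+ (Φ σ T r t C) (λ f → fromℕ 2 * fromℕ (passed f)))
                 (+-congˡ (trans (sum-scale (fromℕ 2) (fromℕ ∘ passed))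
                     (*-congˡ (sym (sum-fromℕ passed))))) ⟩
          sum (Φ σ T r t C) + fromℕ 2 * fromℕ (agreements π ρ e) ∎

    -- Merging the run of ALG with the schedule of OPT.

    paid : Schedule n → Carrier → Configuration σ → Carrier
    paid S τ C = fromℕ 54 * fromℕ (scheduleCost S) + fromℕ 3 * sum (due σ T C S τ)

    -- Relates what remains of the two solutions, which suits an induction on the remaining run and
    -- schedule.
    Amortized : ∀ {st} → Run σ st → Schedule n → Carrier → Configuration σ → Set ℓ₂
    Amortized r S τ C = outstanding σ T r τ ≤ sum (Φ σ T r τ C) + paid S τ C

    amortized-wait : ∀ {st} (r : Run σ st) S τ τ′ C → Joint σ T r τ C → Joint σ T r τ′ C → τ ≤ τ′ →
                     Amortized r S τ′ C → Amortized r S τ C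
    amortized-wait r S τ τ′ C J J′ τ≤τ′ later = begin
      outstanding σ T r τ   ≈⟨ outstanding-wait σ T r τ τ′ ⟩
      outstanding σ T r τ′  ≤⟨ later ⟩
      sum (Φ σ T r τ′ C) + paid S τ′ C
        ≤⟨ +-mono-≤ (Φ-wait σ T r τ τ′ C J J′ τ≤τ′) ≤-refl ⟩
      (sum (Φ σ T r τ C) + fromℕ 3 * sum (incurred σ C τ τ′)) + paid S τ′ C
        ≈⟨ solve 4 (λ φ i a d → (φ :+ con 3 :* i) :+ (a :+ con 3 :* d) := φ :+
            (a :+ con 3 :* (i :+ d))) refl
             (sum (Φ σ T r τ C)) (sum (incurred σ C τ τ′)) (fromℕ 54 * fromℕ (scheduleCost S))
                 (sum (due σ T C S τ′)) ⟩
      sum (Φ σ T r τ C) + (fromℕ 54 * fromℕ (scheduleCost S) + fromℕ 3 * (sum (incurred σ C τ τ′) +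
          sum (due σ T C S τ′)))
        ≈⟨ +-congˡ (+-congˡ (*-congˡ (trans (sum-cong-≋ {m} (due-wait σ T C S τ τ′))
             (∑-distrib-+ (incurred σ C τ τ′) (due σ T C S τ′))))) ⟨
      sum (Φ σ T r τ C) + paid S τ C ∎
      where open ≤-Reasoning

    amortized-perform : ∀ {st} (r : Run σ st) S t a C → Joint σ T r t C →
                        Amortized r S t (perform σ C (t , a)) → Amortized r ((t , a) ∷ S) t C
    amortized-perform r S t a C J later = begin
      outstanding σ T r t
        ≤⟨ later ⟩
      sum (Φ σ T r t C′) + paid S t C′
        ≤⟨ +-mono-≤ (Φ-perform σ T r t C a J) ≤-refl ⟩
      (sum (Φ σ T r t C) + fromℕ 54 * fromℕ (actionCost a)) + paid S t C′
        ≈⟨ solve 4 (λ φ a b d → (φ :+ con 54 :* a) :+ (con 54 :* b :+ d) := φ :+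
            (con 54 :* (a :+ b) :+ d)) refl
             (sum (Φ σ T r t C)) (fromℕ (actionCost a)) (fromℕ (scheduleCost S)) _ ⟩
      sum (Φ σ T r t C) + (fromℕ 54 * (fromℕ (actionCost a) + fromℕ (scheduleCost S)) + fromℕ 3 *
          sum (due σ T C′ S t))
        ≈⟨ +-congˡ (+-cong (*-congˡ (fromℕ-+ (actionCost a) (scheduleCost S)))
             (*-congˡ (sum-cong-≋ {m} (due-perform σ T C t a S)))) ⟨
      sum (Φ σ T r t C) + paid ((t , a) ∷ S) t C ∎
      where
      open ≤-Reasoning
      C′ = perform σ C (t , a)

    amortized-event : ∀ {st} t ev t≥ quiet occ (r : Run σ (handle σ ev (wait σ t st))) S C →
                      Joint σ T {st} (event t ev t≥ quiet occ r) t C →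
                      Amortized r S t C → Amortized {st} (event t ev t≥ quiet occ r) S t C
    amortized-event t (prefixEvent p) t≥ quiet occ r S C J later =
      ≤-respˡ-≈ (sym (outstanding-prefixEvent t p t≥ quiet occ r C J))
        (≤-trans later (+-mono-≤ (Φ-prefixEvent t p t≥ quiet occ r C J) ≤-refl))
    amortized-event {st} t ev@(elementEvent e) t≥ quiet occ r S C J later = begin
      outstanding σ T r⁺ t
        ≈⟨ outstanding-elementEvent t e t≥ quiet occ r C J ⟩
      outstanding σ T r t + x
        ≤⟨ +-mono-≤ later ≤-refl ⟩
      (sum (Φ σ T r t C) + paid S t C) + x
        ≈⟨ solve 3 (λ φ p x → (φ :+ p) :+ x := (φ :+ x) :+ p) refl (sum (Φ σ T r t C)) (paid S t C) x ⟩
      (sum (Φ σ T r t C) + x) + paid S t C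
        ≤⟨ +-mono-≤ (Φ-elementEvent t e t≥ quiet occ r C J) ≤-refl ⟩
      sum (Φ σ T r⁺ t C) + paid S t C ∎
      where
      open ≤-Reasoning
      r⁺ : Run σ st
      r⁺ = event t ev t≥ quiet occ r
      x = fromℕ (rank (positionIn σ st e))

    -- At the horizon no future delay remains, and the potential alone has to cover the counters.
    -- Quietness keeps each counter below the rank of its element, as `E≤ψ` requires.
    amortized-stop : ∀ {st} quiet C → Joint σ T {st} (stop quiet) T C → Amortized {st} (stop quiet) [] T C
    amortized-stop {st} quiet C J = begin
      sum (fut σ T r T) + sum (counterAt σ T st T)
        ≈⟨ trans (+-congʳ (sum-zero {m} (due-horizon σ T (configuration st)))) (+-identityˡ _) ⟩
      sum (counterAt σ T st T)
        ≤⟨ sum-mono {n} (λ e → E≤ψ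
             (inversions (order (configuration st)) (order C) e) (rank (positionIn σ st e))
                 (rank (position (order C) e))
             (rank≤inversions+rank (order (configuration st)) (order C) e)
             (counterAt-nonNeg σ T r T C J e)
             (proj₁ (quiet T (started J) (elementEvent e)))
             (exposure-nonNeg σ T r T C J e)) ⟩
      sum (Φ σ T r T C)
        ≤⟨ a≤a+b _ (+-nonNeg (*-nonNegative (0≤fromℕ 54) ≤-refl)
             (*-nonNegative (0≤fromℕ 3) (≤-reflexive (sym (sum-zero {m} (due-horizon σ T C)))))) ⟩
      sum (Φ σ T r T C) + paid [] T C ∎
      where
      open ≤-Reasoning
      r : Run σ st
      r = stop quiet

    -- Time advances to the next event of ALG or action of OPT, whichever is earlier, and to `T`
    -- when both are exhausted. For simultaneous ones either order is sound.
    amortized : ∀ {st} (r : Run σ st) S τ C → Joint σ T r τ C → Linked _≤_ (τ ∷ map proj₁ S) →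
                Bounded σ T S → Amortized r S τ C
    amortized r@(stop quiet) [] τ C J _ _ =
      amortized-wait r [] τ T C J J′ (τ≤T J) (amortized-stop quiet C J′)
      where J′ = Joint-wait σ T r T C J (τ≤T J) tt ≤-refl
    amortized r@(stop quiet) ((t , a) ∷ S) τ C J (τ≤t ∷ chron) (t≤T ∷ bnd) =
      amortized-wait r ((t , a) ∷ S) τ t C J J′ τ≤t (amortized-perform r S t a C J′
        (amortized r S t _ (Joint-perform σ T r t C a J′) chron bnd))
      where J′ = Joint-wait σ T r t C J τ≤t tt t≤T
    amortized {st} r@(event t ev t≥ quiet occ r′) [] τ C J _ _ =
      amortized-wait r [] τ t C J J′ (until J) (amortized-event t ev t≥ quiet occ r′ [] C J′
        (amortized r′ [] t C (Joint-event t ev t≥ quiet occ r′ C J′) [-] []))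
      where
      J′ = Joint-wait σ T r t C J (until J) ≤-refl
             (event-≤T σ T ev (wait σ t st) (All.++⁻ˡ _ (bounded J)))
    amortized {st} r@(event t ev t≥ quiet occ r′) S⁺@((s , a) ∷ S) τ C J (τ≤s ∷ chron) bnd⁺@(s≤T ∷ bnd) =
      [ (λ s≤t → let J′ = Joint-wait σ T r s C J τ≤s s≤t s≤T in
          amortized-wait r S⁺ τ s C J J′ τ≤s (amortized-perform r S s a C J′
            (amortized r S s _ (Joint-perform σ T r s C a J′) chron bnd)))
      , (λ t≤s → amortized-wait r S⁺ τ t C J J″ (until J) (amortized-event t ev t≥ quiet occ r′ S⁺ C J″
            (amortized r′ S⁺ t C (Joint-event t ev t≥ quiet occ r′ C J″) (t≤s ∷ chron) bnd⁺)))
      ]′ (total s t)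
      where
      J″ = Joint-wait σ T r t C J (until J) ≤-refl
             (event-≤T σ T ev (wait σ t st) (All.++⁻ˡ _ (bounded J)))

    module _ π (r : Run σ (initial σ π)) (0≤T : 0# ≤ T) (bnd : Bounded σ T (schedule σ r)) where

      initial-nonNegative : NonNegative σ (initial σ π)
      initial-nonNegative = record { requests = λ _ → ≤-refl ; elements = λ _ → ≤-refl }

      Joint-initial : Joint σ T r 0# (start σ π)
      Joint-initial = record
        { started     = ≤-refl
        ; until       = Until-start σ r
        ; τ≤T         = 0≤T
        ; nonNegative = initial-nonNegative
        ; bounded     = bnd
        ; arrived     = λ k ()
        }

      Φ-initial : sum (Φ σ T r 0# (start σ π)) ≤ 0#
      Φ-initial = ≤-trans (sum-mono {n} zero-at) (≤-reflexive (sum-zero {n} (λ _ → refl)))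
        where
        zero-at : ∀ e → Φ σ T r 0# (start σ π) e ≤ 0#
        zero-at e = ≤-trans
          (≤-trans
            (≤-reflexive (reflexive (≡.cong (λ I → ψ I x x (counterAt σ T (initial σ π) 0# e)
                (exposure σ T r 0# (start σ π) e))
              (inversions-refl π e))))
            (ψ-monoʳ 0 x x (≤-reflexive (counterAt-now (initial σ π) e))
                (≤-reflexive (sum-zero {m} (λ _ → refl)))))
          (ψ-zero x x)
          where x = rank (position π e)

      competitive : ∀ S → Chronological S → Bounded σ T S →
        fromℕ (scheduleCost (schedule σ r)) + sum (due σ T (start σ π) (schedule σ r) 0#) ≤
        fromℕ 336 * (fromℕ (scheduleCost S) + sum (due σ T (start σ π) S 0#))
      competitive S chron bndS = begin
        fromℕ (scheduleCost (schedule σ r)) + D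
          ≤⟨ +-mono-≤ (≤-trans (actions-≤ σ T r initial-nonNegative bnd 0≤T)
               (≤-reflexive (+-congˡ (+-cong (*-congˡ (sum-zero {m} (λ _ → refl)))
                   (*-congˡ (sum-zero {n} (λ _ → refl))))))) ≤-refl ⟩
        (fromℕ 5 * D + (fromℕ 2 * 0# + fromℕ 3 * 0#)) + D
          ≈⟨ solve 1 (λ d → (con 5 :* d :+ (con 2 :* con 0 :+ con 3 :* con 0)) :+ d := con 6 :* d) refl D ⟩
        fromℕ 6 * D
          ≤⟨ scale-mono 6 D≤ ⟩
        fromℕ 6 * (fromℕ 54 * A + fromℕ 3 * O)
          -- The coefficients are 6 · 54 = 324 and 6 · 3 = 18; the slacks 12 and 318 bring both to
          -- 336.
          ≤⟨ ≤-linear (+-nonNeg (*-nonNegative (0≤fromℕ 12) (0≤fromℕ (scheduleCost S)))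
              (*-nonNegative (0≤fromℕ 318) 0≤O))
               (solve 2 (λ a o → con 6 :* (con 54 :* a :+ con 3 :* o) :+ (con 12 :* a :+ con 318 :* o) :=
                                 con 336 :* (a :+ o) :+ con 0) refl A O) ⟩
        fromℕ 336 * (A + O) ∎
        where
        open ≤-Reasoning
        A = fromℕ (scheduleCost S)
        D = sum (due σ T (start σ π) (schedule σ r) 0#)
        O = sum (due σ T (start σ π) S 0#)
        0≤O : 0# ≤ O
        0≤O = sum-nonNeg {m} (λ k → 0≤y-x
            (≤-respˡ-≈ (sym (delay-upToArrival (σ k) 0# (arrival-nonNeg (σ k)))) (delay-nonNeg (σ k) _)))
        D≤ : D ≤ fromℕ 54 * A + fromℕ 3 * O
        D≤ = begin
          D
            ≤⟨ a≤a+b D (sum-nonNeg {n} (counterAt-nonNeg σ T r 0# (start σ π) Joint-initial)) ⟩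
          outstanding σ T r 0#
            ≤⟨ amortized r S 0# (start σ π) Joint-initial chron bndS ⟩
          sum (Φ σ T r 0# (start σ π)) + (fromℕ 54 * A + fromℕ 3 * O)
            ≤⟨ +-mono-≤ Φ-initial ≤-refl ⟩
          0# + (fromℕ 54 * A + fromℕ 3 * O)
            ≈⟨ +-identityˡ _ ⟩
          fromℕ 54 * A + fromℕ 3 * O ∎

-- From finite horizons to possibly infinite costs.

module Suprema {c ℓ₁ ℓ₂} (ℝ : RealNumbers c ℓ₁ ℓ₂) where

  open Reals ℝ
  open ListUpdate ℝ
  open Request
  open Dynamics ℝ
  open Online ℝ
  open Competitive ℝ

  +⁺-mono-≤ : ∀ {a b x y} → [ a ] ≤⁺ x → [ b ] ≤⁺ y → [ a + b ] ≤⁺ x +⁺ y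
  +⁺-mono-≤ [ a≤x ]     [ b≤y ]     = [ +-mono-≤ a≤x b≤y ]
  +⁺-mono-≤ [ _ ]       (_ ≤⊤⁺)     = _ ≤⊤⁺
  +⁺-mono-≤ (_ ≤⊤⁺)     _           = _ ≤⊤⁺

  +⁺-≤-minus : ∀ {a X y} → y ≤⁺ [ X - a ] → [ a ] +⁺ y ≤⁺ [ X ]
  +⁺-≤-minus {a} {X} {[ y ]} [ y≤X-a ] = [ ≤-respʳ-≈ a+[X-a] (+-monoʳ-≤ a y≤X-a) ]
    where
    a+[X-a] : a + (X - a) ≈ X
    a+[X-a] = trans (solve 3 (λ a X m → a :+ (X :+ m) := X :+ (a :+ m)) refl a X (- a))
      (trans (+-congˡ (-‿inverseʳ a)) (+-identityʳ X))

  ≤-minus : ∀ {a b X} → a + b ≤ X → b ≤ X - a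
  ≤-minus {a} {b} {X} a+b≤X = +-cancelʳ-≤ a (≤-respʳ-≈ (sym [X-a]+a) (≤-respˡ-≈ (+-comm a b) a+b≤X))
    where
    [X-a]+a : (X - a) + a ≈ X
    [X-a]+a = trans (+-assoc X (- a) a) (trans (+-congˡ (-‿inverseˡ a)) (+-identityʳ X))

  minus-≤ : ∀ a {b X} → b ≤ X - a → a + b ≤ X
  minus-≤ a {b} {X} b≤X-a = [≤]-injective _≤_ (+⁺-≤-minus {a} {X} {[ b ]} [ b≤X-a ])

  sum⁺-upper : ∀ {m} (f : Vector Carrier m) (d : Vector Cost m) → (∀ k → [ f k ] ≤⁺ d k) → [ sum f ]
      ≤⁺ sum⁺ d
  sum⁺-upper {zero}  f d f≤d = [ ≤-refl ]
  sum⁺-upper {suc m} f d f≤d = +⁺-mono-≤ (f≤d zero) (sum⁺-upper (f ∘ suc) (d ∘ suc) (f≤d ∘ suc))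

  upper-bound₂ : ∀ a b → ∃[ x ] a ≤ x × b ≤ x
  upper-bound₂ a b with total a b
  ... | inj₁ a≤b = b , a≤b , ≤-refl
  ... | inj₂ b≤a = a , ≤-refl , b≤a

  sum-monotonic : ∀ {m} {f : Fin m → Carrier → Carrier} → (∀ k → Monotonic₁ _≤_ _≤_ (f k)) →
                  Monotonic₁ _≤_ _≤_ (λ t → sum (λ k → f k t))
  sum-monotonic {m} mono s≤t = sum-mono {m} (λ k → mono k s≤t)

  supremum-minus : ∀ {f : Carrier → Carrier} {s} y X → IsSupremum f s → (∀ t → y + f t ≤ X) → s ≤⁺ [ X - y ]
  supremum-minus y X (_ , least) y+f≤X = least [ X - y ] (λ t → [ ≤-minus (y+f≤X t) ])

  -- Monotone functions approach their suprema simultaneously.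
  sum⁺-least : ∀ {m} (f : Fin m → Carrier → Carrier) (d : Vector Cost m) T₀ X →
               (∀ k → Monotonic₁ _≤_ _≤_ (f k)) → (∀ k → IsSupremum (f k) (d k)) →
               (∀ T → T₀ ≤ T → sum (λ k → f k T) ≤ X) → sum⁺ d ≤⁺ [ X ]
  sum⁺-least {zero}  f d T₀ X mono sup bound = [ bound T₀ ≤-refl ]
  sum⁺-least {suc m} f d T₀ X mono sup bound = combine (d zero) (λ T T₀≤T →
      supremum-minus (tail T) X (sup zero) (tail+head T T₀≤T))
    where
    tail : Carrier → Carrier
    tail t = sum (λ k → f (suc k) t)
    -- Head and tail are taken at unrelated times; monotonicity replaces both by their values at a
    -- common later time.
    tail+head : ∀ T → T₀ ≤ T → ∀ t → tail T + f zero t ≤ X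
    tail+head T T₀≤T t with upper-bound₂ T t
    ... | u , T≤u , t≤u = ≤-trans (≤-trans
      (+-mono-≤ (sum-monotonic (mono ∘ suc) T≤u) (mono zero t≤u))
      (≤-reflexive (+-comm (tail u) (f zero u)))) (bound u (≤-trans T₀≤T T≤u))
    -- With the tail fixed, `X - tail T` bounds the supremum of the head, which is therefore finite.
    -- It can then be subtracted from `X` for the induction on the tail.
    combine : ∀ x → (∀ T → T₀ ≤ T → x ≤⁺ [ X - tail T ]) → x +⁺ sum⁺ (d ∘ suc) ≤⁺ [ X ]
    combine ⊤⁺    x≤ with () ← x≤ T₀ ≤-refl
    combine [ x ] x≤ = +⁺-≤-minus (sum⁺-least (f ∘ suc) (d ∘ suc) T₀ (X - x) (mono ∘ suc) (sup ∘ suc)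
      (λ T T₀≤T → ≤-minus (≤-respˡ-≈ (+-comm (tail T) x)
        (minus-≤ (tail T) ([≤]-injective _≤_ (x≤ T T₀≤T))))))

  module _ {n m} (σ : Input n m) where

    cutoff : Maybe Carrier → Fin m → Carrier → Carrier
    cutoff q k T = delay (σ k) (fromMaybe T q)

    cutoff-monotonic : ∀ q k → Monotonic₁ _≤_ _≤_ (cutoff q k)
    cutoff-monotonic (just s) k T≤T′ = ≤-refl
    cutoff-monotonic nothing  k T≤T′ = delay-mono (σ k) T≤T′

    -- For a served request the cutoff is constant, for the others it is the delay function. So
    -- every delay cost is the supremum of a monotone function of the horizon.
    cutoff-supremum : ∀ {q d} k → IsDelayCost σ (delay (σ k)) q d → IsSupremum (cutoff q k) d
    cutoff-supremum k (servedAt s)      = (λ _ → [ ≤-refl ]) , (λ _ upper → upper s)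
    cutoff-supremum k (neverServed sup) = sup

    finally : Order n → Schedule n → Configuration σ
    finally π S = foldl (perform σ) (start σ π) S

    due-start : ∀ T π S k → due σ T (start σ π) S 0# k ≈ cutoff (served (finally π S) k) k T
    due-start T π S k = trans (+-congˡ (trans (-‿cong D0≈0) -0≈0)) (+-identityʳ _)
      where
      D0≈0 = delay-upToArrival (σ k) 0# (arrival-nonNeg (σ k))
      -0≈0 : - 0# ≈ 0#
      -0≈0 = trans (sym (+-identityˡ (- 0#))) (-‿inverseʳ 0#)

  horizon : ∀ {n} (S : Schedule n) → ∃[ T ] 0# ≤ T × All (λ (t , _) → t ≤ T) S
  horizon []            = 0# , ≤-refl , []
  horizon ((t , _) ∷ S) with horizon S
  ... | T , 0≤T , S≤T with upper-bound₂ t T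
  ...   | T′ , t≤T′ , T≤T′ = T′ , ≤-trans 0≤T T≤T′ , t≤T′ ∷ All.map (λ t≤T → ≤-trans t≤T T≤T′) S≤T

-- The competitive ratio.

theorem2 : ∀ {c ℓ₁ ℓ₂} (ℝ : RealNumbers c ℓ₁ ℓ₂) →
    let open ListUpdate ℝ in
    ∀ {n m} (σ : Input n m) (π : Order n) (alg opt : Cost) →
    IsALG σ π alg → IsOPT σ π opt →
    alg ≤⁺ 336 *⁺ opt
theorem2 ℝ σ π alg ⊤⁺    _ _ = alg ≤⊤⁺
theorem2 ℝ {m = m} σ π _ [ opt ] (r , dᴬ , isDelayᴬ , ≡.refl)
    ((S , chronological , dᴼ , isDelayᴼ , opt≡) , _) =
  +⁺-≤-minus (sum⁺-least fᴬ dᴬ T₀ (fromℕ 336 * opt - A)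
    (λ k → cutoff-monotonic σ (served (finally σ π Sᴬ) k) k)
    (λ k → cutoff-supremum σ k (isDelayᴬ k))
    (λ T T₀≤T → ≤-minus (bound T T₀≤T)))
  where
  open Reals ℝ
  open ListUpdate ℝ
  open Online ℝ
  open Dynamics ℝ
  open Competitive ℝ
  open Suprema ℝ
  open ≤-Reasoning
  Sᴬ = schedule σ r
  A = fromℕ (scheduleCost Sᴬ)
  O = fromℕ (scheduleCost S)
  fᴬ fᴼ : Fin m → Carrier → Carrier
  fᴬ k = cutoff σ (served (finally σ π Sᴬ) k) k
  fᴼ k = cutoff σ (served (finally σ π S) k) k
  -- A horizon beyond all actions of both schedules. Every later one has this property too, as the
  -- passage to suprema requires.
  T₀ = proj₁ (horizon (Sᴬ ++ S))
  0≤T₀ = proj₁ (proj₂ (horizon (Sᴬ ++ S)))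
  bounded₀ = proj₂ (proj₂ (horizon (Sᴬ ++ S)))

  O+delay≤opt : ∀ T → O + sum (λ k → fᴼ k T) ≤ opt
  O+delay≤opt T = [≤]-injective _≤_ (≡.subst ([ O + sum (λ k → fᴼ k T) ] ≤⁺_) (≡.sym opt≡)
    (+⁺-mono-≤ [ ≤-refl ] (sum⁺-upper (λ k → fᴼ k T) dᴼ
        (λ k → proj₁ (cutoff-supremum σ k (isDelayᴼ k)) T))))

  bound : ∀ T → T₀ ≤ T → A + sum (λ k → fᴬ k T) ≤ fromℕ 336 * opt
  bound T T₀≤T = begin
    A + sum (λ k → fᴬ k T)
      ≈⟨ +-congˡ (sum-cong-≋ {m} (due-start σ T π Sᴬ)) ⟨
    A + sum (due σ T (start σ π) Sᴬ 0#)
      ≤⟨ competitive σ T π r (≤-trans 0≤T₀ T₀≤T) (All.++⁻ˡ Sᴬ bounded) S chronological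
          (All.++⁻ʳ Sᴬ bounded) ⟩
    fromℕ 336 * (O + sum (due σ T (start σ π) S 0#))
      ≈⟨ *-congˡ (+-congˡ (sum-cong-≋ {m} (due-start σ T π S))) ⟩
    fromℕ 336 * (O + sum (λ k → fᴼ k T))
      ≤⟨ scale-mono 336 (O+delay≤opt T) ⟩
    fromℕ 336 * opt ∎
    where bounded = All.map (λ t≤T₀ → ≤-trans t≤T₀ T₀≤T) bounded₀
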